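{- Let $(\mathcal{L}_n(x))_{n\ge 0}$ be a Lucas-type polynomial sequence determined by $p_0$, $p_1(x)$, $d(x)=\alpha p_1(x)$ and $g(x)$. Let $q>2$ be a prime number and let $d(x)=a_kx^k+a_{k-1}x^{k-1}+\dots+a_1x+a_0$, where $a_k\not\equiv 0 \pmod q$ and $a_i\equiv 0\pmod q$ for $i=0,1,\dots,k-1$. If $g(0)\not\equiv 0\pmod q$, then $\mathcal{L}_q(x)/p_1(x)$ is irreducible over $\mathbb{Q}$.
   Context: A Lucas-type polynomial sequence is determined by an integer $p_0$ with $|p_0|\in\{1,2\}$ and non-zero polynomials $p_1(x),g(x)\in\mathbb{Z}[x]$; put $\alpha=2/p_0\in\mathbb{Z}$ and $d(x)=\alpha p_1(x)$. Then $\mathcal{L}_0(x)=p_0$, $\mathcal{L}_1(x)=p_1(x)$, and $\mathcal{L}_n(x)=d(x)\mathcal{L}_{n-1}(x)+g(x)\mathcal{L}_{n-2}(x)$ for $n\ge 2$. Standing assumptions: $\gcd(d(x),g(x))=1$, $\deg(g)<\deg(d)$, $\gcd(p_0,p_1(x))=\gcd(p_0,d(x))=\gcd(p_0,g(x))=1$, and $\deg(p_1)\ge 1$ (so $k\ge1$), where $\gcd=1$ means that the only common divisors in $\mathbb{Z}[x]$ are $\pm 1$. -}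

module Defs where

open import Algebra.Bundles using (RawSemiring)
open import Data.Integer as ℤ using (ℤ; +_; -[1+_])
import Data.Integer.DivMod as ℤ
open import Data.List using (List; []; _∷_; map)
open import Data.Nat as ℕ using (ℕ; zero; suc; _≤_; _<_)
open import Data.Product using (∃; ∃₂; _×_)
open import Data.Rational as ℚ using (ℚ)
open import Data.Sum using (_⊎_; inj₁; inj₂)
open import Relation.Binary.PropositionalEquality using (_≡_; sym; subst)
open import Relation.Nullary using (¬_)

-- A polynomial is the list of its coefficients, constant term first.  Trailing
-- zeros are allowed, so the equality to use on polynomials is _≈ₚ_, not _≡_.
module Polynomial {c ℓ} (R : RawSemiring c ℓ) where
  open RawSemiring R

  infix  4 _≈ₚ_
  infixl 6 _+ₚ_
  infixl 7 _*ₚ_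
  infixr 7 _·ₚ_

  Poly : Set c
  Poly = List Carrier

  coeff : Poly → ℕ → Carrier
  coeff []      _       = 0#
  coeff (a ∷ p) zero    = a
  coeff (a ∷ p) (suc n) = coeff p n

  -- A record rather than a bare function type, so that p and q can be inferred.
  record _≈ₚ_ (p q : Poly) : Set ℓ where
    constructor mk≈ₚ
    field
      coeff-≈ : ∀ n → coeff p n ≈ coeff q n

  const : Carrier → Poly
  const a = a ∷ []

  _+ₚ_ : Poly → Poly → Poly
  []      +ₚ q       = q
  (a ∷ p) +ₚ []      = a ∷ p
  (a ∷ p) +ₚ (b ∷ q) = (a + b) ∷ (p +ₚ q)

  _·ₚ_ : Carrier → Poly → Poly
  a ·ₚ p = map (a *_) p

  _*ₚ_ : Poly → Poly → Poly
  []      *ₚ q = []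
  (a ∷ p) *ₚ q = (a ·ₚ q) +ₚ (0# ∷ (p *ₚ q))

  eval : Poly → Carrier → Carrier
  eval []      x = 0#
  eval (a ∷ p) x = a + x * eval p x

  -- The zero polynomial has no degree.
  HasDegree : Poly → ℕ → Set ℓ
  HasDegree p n = ¬ (coeff p n ≈ 0#) × (∀ m → n < m → coeff p m ≈ 0#)

  rawSemiring : RawSemiring c ℓ
  rawSemiring = record
    { Carrier = Poly
    ; _≈_     = _≈ₚ_
    ; _+_     = _+ₚ_
    ; _*_     = _*ₚ_
    ; 0#      = []
    ; 1#      = const 1#
    }

  open import Algebra.Definitions.RawSemiring rawSemiring public
    using (Irreducible) renaming (_∣_ to _∣ₚ_)

module ℤ[x] = Polynomial ℤ.+-*-rawSemiring
module ℚ[x] = Polynomial ℚ.+-*-rawSemiring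

open ℤ[x]

ℤ[x]→ℚ[x] : ℤ[x].Poly → ℚ[x].Poly
ℤ[x]→ℚ[x] = map (λ z → z ℚ./ 1)

IrreducibleOverℚ : ℤ[x].Poly → Set
IrreducibleOverℚ f = ℚ[x].Irreducible (ℤ[x]→ℚ[x] f)

GcdIsOne : Poly → Poly → Set
GcdIsOne p q = ∀ c → c ∣ₚ p → c ∣ₚ q → c ≈ₚ const (+ 1) ⊎ c ≈ₚ const -[1+ 0 ]

record LucasType : Set where
  field
    p₀     : ℤ
    p₁ g   : Poly
    ∣p₀∣   : ℤ.∣ p₀ ∣ ≡ 1 ⊎ ℤ.∣ p₀ ∣ ≡ 2
    p₁≉0   : ¬ (p₁ ≈ₚ [])
    g≉0    : ¬ (g ≈ₚ [])

  p₀-nonZero : ℤ.NonZero p₀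
  p₀-nonZero with ∣p₀∣
  ... | inj₁ eq = subst ℕ.NonZero (sym eq) _
  ... | inj₂ eq = subst ℕ.NonZero (sym eq) _

  -- Integer division, exact here because p₀ ∈ {±1, ±2}.
  α : ℤ
  α = ((+ 2) ℤ./ p₀) {{p₀-nonZero}}

  d : Poly
  d = α ·ₚ p₁

  L : ℕ → Poly
  L zero          = const p₀
  L (suc zero)    = p₁
  L (suc (suc n)) = d *ₚ L (suc n) +ₚ g *ₚ L n

record StandingAssumptions (S : LucasType) : Set where
  open LucasType S
  field
    gcd-d-g   : GcdIsOne d g
    deg-g<d   : ∃₂ λ m n → HasDegree g m × HasDegree d n × m < n
    gcd-p₀-p₁ : GcdIsOne (const p₀) p₁
    gcd-p₀-d  : GcdIsOne (const p₀) d
    gcd-p₀-g  : GcdIsOne (const p₀) g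
    deg-p₁≥1  : ∃ λ n → HasDegree p₁ n × 1 ≤ n

{-# OPTIONS --safe #-}

-- With q = 2m + 1, the polynomial L_q / p₁ is a homogeneous form of degree m in
-- d² and g whose coefficients at positive powers of g are divisible by q, and
-- whose coefficients at d²ᵐ and gᵐ are 1 and q.  As d ≡ a_k xᵏ modulo q, it is a
-- non-zero multiple of x^(2mk) modulo q, and its constant term is q g(0)ᵐ modulo
-- q².  Since deg g < deg d it has degree 2mk, so Eisenstein's criterion at q
-- applies.
module Submission where

open import Defs
open import Algebra.Bundles using (CommutativeSemiring; CommutativeRing)
open import Algebra.Definitions.RawMagma using (_,_)
open import Data.Integer as ℤ using (ℤ; +_; -[1+_]; 0ℤ; 1ℤ)
import Data.Integer.DivMod as ℤ
open import Data.Integer.Divisibility using (_∣_)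
open import Data.Integer.Divisibility.Signed
  using (divides; ∣ᵤ⇒∣; ∣⇒∣ᵤ; ∣-refl; ∣-trans; _∣?_; ∣m∣n⇒∣m+n; ∣m+n∣m⇒∣n; ∣m+n∣n⇒∣m
        ; ∣n⇒∣m*n; ∣m⇒∣m*n; *-monoʳ-∣; *-monoˡ-∣; *-cancelˡ-∣; *-cancelʳ-∣)
  renaming (_∣_ to _∣ₛ_)
import Data.Integer.Properties as ℤ
open import Data.List using ([]; _∷_; applyUpTo)
open import Data.Nat as ℕ using (ℕ; zero; suc; _<_; _≤_; z≤n; s≤s; NonZero)
open import Data.Nat.Combinatorics using (_C_; nCn≡1; nC1≡n; k>n⇒nCk≡0; nCk+nC[k+1]≡[n+1]C[k+1])
import Data.Nat.Divisibility as ℕ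
import Data.Nat.DivMod as ℕ
open import Data.Nat.Induction using (<-rec)
open import Data.Nat.Primality
  using (Prime; euclidsLemma; prime⇒irreducible; prime⇒nonZero; prime⇒nonTrivial; ¬prime[1])
import Data.Nat.Properties as ℕ
open import Data.Nat.Tactic.RingSolver using (solve-∀)
open import Data.Product using (∃; _×_; _,_; proj₁; proj₂)
open import Data.Rational as ℚ using (ℚ; mkℚ; toℚᵘ; 1ℚ)
import Data.Rational.Properties as ℚ
open import Data.Rational.Unnormalised as ℚᵘ using (mkℚᵘ; *≡*)
import Data.Rational.Unnormalised.Properties as ℚᵘ
open import Data.Sum as ⊎ using (_⊎_; inj₁; inj₂; [_,_]′)
open import Relation.Binary.Bundles using (Setoid)
open import Relation.Binary.Definitions using (tri<; tri≈; tri>)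
import Relation.Binary.PropositionalEquality as ≡
import Relation.Binary.Reasoning.Setoid as SetoidReasoning
open import Relation.Nullary using (¬_; yes; no; contradiction)

-- The semiring of polynomials

-- The coefficient of d^(N-2i) g^i in the Lucas polynomial of index N with initial values 2 and d is
-- N/(N-i) * C(N-i, i). For N = q and i > 0 the denominator q-i is smaller than q, so the factor q
-- cannot cancel. The scalar α is harmless: α L_n has initial values 2 and d, and every term of odd
-- index contains d = α p₁.
--
-- Irreducibility is wanted over ℚ, whereas Eisenstein's argument takes place in ℤ[x]. Clearing
-- denominators in a factorisation of f gives X Y = c f with an integer c that may itself be
-- divisible by q. Only the powers of q in c do harm, so Gauss' lemma is used at the single prime q,
-- without contents or primitive polynomials.
--
-- The field with q elements is not constructed either. Of a reduction modulo q only its order at x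
-- is recorded. Orders add under multiplication because q is prime, an order never exceeds the
-- degree, and for f the two agree; this forces them to agree for each factor.

module PolynomialProperties {c ℓ} (R : CommutativeSemiring c ℓ) where
  open CommutativeSemiring R
  open Polynomial rawSemiring hiding (rawSemiring)
  open _≈ₚ_ public

  coeff-+ₚ : ∀ p q n → coeff (p +ₚ q) n ≈ coeff p n + coeff q n
  coeff-+ₚ []      q       n       = sym (+-identityˡ _)
  coeff-+ₚ (a ∷ p) []      n       = sym (+-identityʳ _)
  coeff-+ₚ (a ∷ p) (b ∷ q) zero    = refl
  coeff-+ₚ (a ∷ p) (b ∷ q) (suc n) = coeff-+ₚ p q n

  coeff-·ₚ : ∀ a p n → coeff (a ·ₚ p) n ≈ a * coeff p n
  coeff-·ₚ a []      n       = sym (zeroʳ a)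
  coeff-·ₚ a (b ∷ p) zero    = refl
  coeff-·ₚ a (b ∷ p) (suc n) = coeff-·ₚ a p n

  polySetoid : Setoid c ℓ
  polySetoid = record
    { Carrier       = Poly
    ; _≈_           = _≈ₚ_
    ; isEquivalence = record
      { refl  = mk≈ₚ λ _ → refl
      ; sym   = λ p≈q → mk≈ₚ λ n → sym (coeff-≈ p≈q n)
      ; trans = λ p≈q q≈r → mk≈ₚ λ n → trans (coeff-≈ p≈q n) (coeff-≈ q≈r n)
      }
    }

  open Setoid polySetoid public using () renaming (refl to ≈ₚ-refl; sym to ≈ₚ-sym; trans to ≈ₚ-trans)

  ∷-cong : ∀ {a b p q} → a ≈ b → p ≈ₚ q → (a ∷ p) ≈ₚ (b ∷ q)
  ∷-cong a≈b p≈q = mk≈ₚ λ { zero → a≈b ; (suc n) → coeff-≈ p≈q n }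

  0∷[]≈[] : (0# ∷ []) ≈ₚ []
  0∷[]≈[] = mk≈ₚ λ { zero → refl ; (suc n) → refl }

  +ₚ-cong : ∀ {p p′ q q′} → p ≈ₚ p′ → q ≈ₚ q′ → p +ₚ q ≈ₚ p′ +ₚ q′
  +ₚ-cong {p} {p′} {q} {q′} p≈p′ q≈q′ = mk≈ₚ λ n →
    trans (coeff-+ₚ p q n)
      (trans (+-cong (coeff-≈ p≈p′ n) (coeff-≈ q≈q′ n)) (sym (coeff-+ₚ p′ q′ n)))

  +ₚ-assoc : ∀ p q r → (p +ₚ q) +ₚ r ≈ₚ p +ₚ (q +ₚ r)
  +ₚ-assoc p q r = mk≈ₚ λ n → begin
    coeff ((p +ₚ q) +ₚ r) n             ≈⟨ coeff-+ₚ (p +ₚ q) r n ⟩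
    coeff (p +ₚ q) n + coeff r n        ≈⟨ +-congʳ (coeff-+ₚ p q n) ⟩
    coeff p n + coeff q n + coeff r n   ≈⟨ +-assoc _ _ _ ⟩
    coeff p n + (coeff q n + coeff r n) ≈⟨ +-congˡ (coeff-+ₚ q r n) ⟨
    coeff p n + coeff (q +ₚ r) n        ≈⟨ coeff-+ₚ p (q +ₚ r) n ⟨
    coeff (p +ₚ (q +ₚ r)) n             ∎
    where open SetoidReasoning setoid

  +ₚ-comm : ∀ p q → p +ₚ q ≈ₚ q +ₚ p
  +ₚ-comm p q = mk≈ₚ λ n →
    trans (coeff-+ₚ p q n) (trans (+-comm _ _) (sym (coeff-+ₚ q p n)))

  +ₚ-identityʳ : ∀ p → p +ₚ [] ≈ₚ p
  +ₚ-identityʳ []      = ≈ₚ-refl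
  +ₚ-identityʳ (a ∷ p) = ≈ₚ-refl

  ·ₚ-cong : ∀ {a b p q} → a ≈ b → p ≈ₚ q → a ·ₚ p ≈ₚ b ·ₚ q
  ·ₚ-cong {a} {b} {p} {q} a≈b p≈q = mk≈ₚ λ n →
    trans (coeff-·ₚ a p n) (trans (*-cong a≈b (coeff-≈ p≈q n)) (sym (coeff-·ₚ b q n)))

  ·ₚ-congˡ : ∀ a {p q} → p ≈ₚ q → a ·ₚ p ≈ₚ a ·ₚ q
  ·ₚ-congˡ a = ·ₚ-cong refl

  ·ₚ-assoc : ∀ a b p → a ·ₚ (b ·ₚ p) ≈ₚ (a * b) ·ₚ p
  ·ₚ-assoc a b p = mk≈ₚ λ n → begin
    coeff (a ·ₚ (b ·ₚ p)) n ≈⟨ coeff-·ₚ a (b ·ₚ p) n ⟩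
    a * coeff (b ·ₚ p) n    ≈⟨ *-congˡ (coeff-·ₚ b p n) ⟩
    a * (b * coeff p n)     ≈⟨ *-assoc a b _ ⟨
    a * b * coeff p n       ≈⟨ coeff-·ₚ (a * b) p n ⟨
    coeff ((a * b) ·ₚ p) n  ∎
    where open SetoidReasoning setoid

  ·ₚ-identityˡ : ∀ p → 1# ·ₚ p ≈ₚ p
  ·ₚ-identityˡ p = mk≈ₚ λ n → trans (coeff-·ₚ 1# p n) (*-identityˡ _)

  ·ₚ-zeroˡ : ∀ p → 0# ·ₚ p ≈ₚ []
  ·ₚ-zeroˡ p = mk≈ₚ λ n → trans (coeff-·ₚ 0# p n) (zeroˡ _)

  ·ₚ-distribˡ : ∀ a p q → a ·ₚ (p +ₚ q) ≈ₚ a ·ₚ p +ₚ a ·ₚ q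
  ·ₚ-distribˡ a p q = mk≈ₚ λ n → begin
    coeff (a ·ₚ (p +ₚ q)) n               ≈⟨ coeff-·ₚ a (p +ₚ q) n ⟩
    a * coeff (p +ₚ q) n                  ≈⟨ *-congˡ (coeff-+ₚ p q n) ⟩
    a * (coeff p n + coeff q n)           ≈⟨ distribˡ a _ _ ⟩
    a * coeff p n + a * coeff q n         ≈⟨ +-cong (coeff-·ₚ a p n) (coeff-·ₚ a q n) ⟨
    coeff (a ·ₚ p) n + coeff (a ·ₚ q) n   ≈⟨ coeff-+ₚ (a ·ₚ p) (a ·ₚ q) n ⟨
    coeff (a ·ₚ p +ₚ a ·ₚ q) n            ∎
    where open SetoidReasoning setoid

  ·ₚ-distribʳ : ∀ a b p → (a + b) ·ₚ p ≈ₚ a ·ₚ p +ₚ b ·ₚ p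
  ·ₚ-distribʳ a b p = mk≈ₚ λ n → begin
    coeff ((a + b) ·ₚ p) n                ≈⟨ coeff-·ₚ (a + b) p n ⟩
    (a + b) * coeff p n                   ≈⟨ distribʳ _ a b ⟩
    a * coeff p n + b * coeff p n         ≈⟨ +-cong (coeff-·ₚ a p n) (coeff-·ₚ b p n) ⟨
    coeff (a ·ₚ p) n + coeff (b ·ₚ p) n   ≈⟨ coeff-+ₚ (a ·ₚ p) (b ·ₚ p) n ⟨
    coeff (a ·ₚ p +ₚ b ·ₚ p) n            ∎
    where open SetoidReasoning setoid

  module ≈ₚ-Reasoning = SetoidReasoning polySetoid

  +ₚ-interchange : ∀ p q r s → (p +ₚ q) +ₚ (r +ₚ s) ≈ₚ (p +ₚ r) +ₚ (q +ₚ s)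
  +ₚ-interchange p q r s = begin
    (p +ₚ q) +ₚ (r +ₚ s) ≈⟨ +ₚ-assoc p q _ ⟩
    p +ₚ (q +ₚ (r +ₚ s)) ≈⟨ +ₚ-cong (≈ₚ-refl {p}) q[rs]≈r[qs] ⟩
    p +ₚ (r +ₚ (q +ₚ s)) ≈⟨ +ₚ-assoc p r _ ⟨
    (p +ₚ r) +ₚ (q +ₚ s) ∎
    where
    open ≈ₚ-Reasoning
    q[rs]≈r[qs] : q +ₚ (r +ₚ s) ≈ₚ r +ₚ (q +ₚ s)
    q[rs]≈r[qs] = begin
      q +ₚ (r +ₚ s) ≈⟨ +ₚ-assoc q r s ⟨
      (q +ₚ r) +ₚ s ≈⟨ +ₚ-cong (+ₚ-comm q r) (≈ₚ-refl {s}) ⟩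
      (r +ₚ q) +ₚ s ≈⟨ +ₚ-assoc r q s ⟩
      r +ₚ (q +ₚ s) ∎

  *ₚ-congˡ : ∀ p {q r} → q ≈ₚ r → p *ₚ q ≈ₚ p *ₚ r
  *ₚ-congˡ []      q≈r = ≈ₚ-refl
  *ₚ-congˡ (a ∷ p) q≈r = +ₚ-cong (·ₚ-congˡ a q≈r) (∷-cong refl (*ₚ-congˡ p q≈r))

  *ₚ-zeroʳ : ∀ p → p *ₚ [] ≈ₚ []
  *ₚ-zeroʳ []      = ≈ₚ-refl
  *ₚ-zeroʳ (a ∷ p) = ≈ₚ-trans (∷-cong refl (*ₚ-zeroʳ p)) 0∷[]≈[]

  *ₚ-∷ : ∀ p b q → p *ₚ (b ∷ q) ≈ₚ b ·ₚ p +ₚ (0# ∷ p *ₚ q)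
  *ₚ-∷ []      b q = ≈ₚ-sym 0∷[]≈[]
  *ₚ-∷ (a ∷ p) b q = ∷-cong (+-congʳ (*-comm a b)) (begin
    a ·ₚ q +ₚ p *ₚ (b ∷ q)                ≈⟨ +ₚ-cong (≈ₚ-refl {a ·ₚ q}) (*ₚ-∷ p b q) ⟩
    a ·ₚ q +ₚ (b ·ₚ p +ₚ (0# ∷ p *ₚ q))   ≈⟨ +ₚ-assoc (a ·ₚ q) (b ·ₚ p) _ ⟨
    (a ·ₚ q +ₚ b ·ₚ p) +ₚ (0# ∷ p *ₚ q)   ≈⟨ +ₚ-cong (+ₚ-comm (a ·ₚ q) (b ·ₚ p)) ≈ₚ-refl ⟩
    (b ·ₚ p +ₚ a ·ₚ q) +ₚ (0# ∷ p *ₚ q)   ≈⟨ +ₚ-assoc (b ·ₚ p) (a ·ₚ q) _ ⟩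
    b ·ₚ p +ₚ (a ∷ p) *ₚ q                ∎)
    where open ≈ₚ-Reasoning

  *ₚ-comm : ∀ p q → p *ₚ q ≈ₚ q *ₚ p
  *ₚ-comm []      q = ≈ₚ-sym (*ₚ-zeroʳ q)
  *ₚ-comm (a ∷ p) q =
    ≈ₚ-trans (+ₚ-cong ≈ₚ-refl (∷-cong refl (*ₚ-comm p q))) (≈ₚ-sym (*ₚ-∷ q a p))

  -- Equal polynomials may be lists of different lengths, which makes recursion on the left factor
  -- awkward; commutativity moves each change to the right factor.
  *ₚ-cong : ∀ {p p′ q q′} → p ≈ₚ p′ → q ≈ₚ q′ → p *ₚ q ≈ₚ p′ *ₚ q′
  *ₚ-cong {p} {p′} {q} {q′} p≈p′ q≈q′ = begin
    p *ₚ q   ≈⟨ *ₚ-congˡ p q≈q′ ⟩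
    p *ₚ q′  ≈⟨ *ₚ-comm p q′ ⟩
    q′ *ₚ p  ≈⟨ *ₚ-congˡ q′ p≈p′ ⟩
    q′ *ₚ p′ ≈⟨ *ₚ-comm q′ p′ ⟩
    p′ *ₚ q′ ∎
    where open ≈ₚ-Reasoning

  *ₚ-distribˡ : ∀ p q r → p *ₚ (q +ₚ r) ≈ₚ p *ₚ q +ₚ p *ₚ r
  *ₚ-distribˡ []      q r = ≈ₚ-refl
  *ₚ-distribˡ (a ∷ p) q r = ≈ₚ-trans
    (+ₚ-cong (·ₚ-distribˡ a q r) (∷-cong (sym (+-identityʳ 0#)) (*ₚ-distribˡ p q r)))
    (+ₚ-interchange (a ·ₚ q) (a ·ₚ r) (0# ∷ p *ₚ q) (0# ∷ p *ₚ r))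

  *ₚ-distribʳ : ∀ p q r → (q +ₚ r) *ₚ p ≈ₚ q *ₚ p +ₚ r *ₚ p
  *ₚ-distribʳ p q r = begin
    (q +ₚ r) *ₚ p     ≈⟨ *ₚ-comm (q +ₚ r) p ⟩
    p *ₚ (q +ₚ r)     ≈⟨ *ₚ-distribˡ p q r ⟩
    p *ₚ q +ₚ p *ₚ r  ≈⟨ +ₚ-cong (*ₚ-comm p q) (*ₚ-comm p r) ⟩
    q *ₚ p +ₚ r *ₚ p  ∎
    where open ≈ₚ-Reasoning

  ·ₚ-*ₚ-assoc : ∀ a p q → (a ·ₚ p) *ₚ q ≈ₚ a ·ₚ (p *ₚ q)
  ·ₚ-*ₚ-assoc a []      q = ≈ₚ-refl
  ·ₚ-*ₚ-assoc a (b ∷ p) q = ≈ₚ-trans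
    (+ₚ-cong (≈ₚ-sym (·ₚ-assoc a b q)) (∷-cong (sym (zeroʳ a)) (·ₚ-*ₚ-assoc a p q)))
    (≈ₚ-sym (·ₚ-distribˡ a (b ·ₚ q) (0# ∷ p *ₚ q)))

  *ₚ-·ₚ-comm : ∀ a p q → p *ₚ (a ·ₚ q) ≈ₚ a ·ₚ (p *ₚ q)
  *ₚ-·ₚ-comm a p q = begin
    p *ₚ (a ·ₚ q)  ≈⟨ *ₚ-comm p (a ·ₚ q) ⟩
    (a ·ₚ q) *ₚ p  ≈⟨ ·ₚ-*ₚ-assoc a q p ⟩
    a ·ₚ (q *ₚ p)  ≈⟨ ·ₚ-congˡ a (*ₚ-comm q p) ⟩
    a ·ₚ (p *ₚ q)  ∎
    where open ≈ₚ-Reasoning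

  *ₚ-assoc : ∀ p q r → (p *ₚ q) *ₚ r ≈ₚ p *ₚ (q *ₚ r)
  *ₚ-assoc []      q r = ≈ₚ-refl
  *ₚ-assoc (a ∷ p) q r = begin
    (a ·ₚ q +ₚ (0# ∷ p *ₚ q)) *ₚ r                    ≈⟨ *ₚ-distribʳ r (a ·ₚ q) (0# ∷ p *ₚ q) ⟩
    (a ·ₚ q) *ₚ r +ₚ (0# ·ₚ r +ₚ (0# ∷ (p *ₚ q) *ₚ r)) ≈⟨ +ₚ-cong (·ₚ-*ₚ-assoc a q r) (+ₚ-cong (·ₚ-zeroˡ r) (∷-cong refl (*ₚ-assoc p q r))) ⟩
    a ·ₚ (q *ₚ r) +ₚ (0# ∷ p *ₚ (q *ₚ r))              ∎
    where open ≈ₚ-Reasoning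

  *ₚ-identityˡ : ∀ p → const 1# *ₚ p ≈ₚ p
  *ₚ-identityˡ p = begin
    1# ·ₚ p +ₚ (0# ∷ [])  ≈⟨ +ₚ-cong (·ₚ-identityˡ p) 0∷[]≈[] ⟩
    p +ₚ []               ≈⟨ +ₚ-identityʳ p ⟩
    p                     ∎
    where open ≈ₚ-Reasoning

-- Binary forms evaluated at polynomials

module HomogeneousForms {c ℓ} (R : CommutativeSemiring c ℓ) where
  open CommutativeSemiring R
  open Polynomial rawSemiring hiding (rawSemiring)
  open PolynomialProperties R

  infixr 8 _^ₚ_
  _^ₚ_ : Poly → ℕ → Poly
  p ^ₚ zero  = const 1#
  p ^ₚ suc n = p *ₚ p ^ₚ n

  -- form u v c n = Σ_{j+i=n} c(j,i) uʲ vⁱ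
  form : Poly → Poly → (ℕ → ℕ → Carrier) → ℕ → Poly
  form u v c zero    = const (c 0 0)
  form u v c (suc n) = u *ₚ form u v (λ j → c (suc j)) n +ₚ c 0 (suc n) ·ₚ v ^ₚ suc n

  -- Multiplying a form by `u` or by `v` shifts its array of coefficients. A recurrence between
  -- forms thus becomes a Pascal-like recurrence between arrays.
  shiftˡ shiftʳ : (ℕ → ℕ → Carrier) → ℕ → ℕ → Carrier
  shiftˡ c zero    i = 0#
  shiftˡ c (suc j) i = c j i
  shiftʳ c j zero    = 0#
  shiftʳ c j (suc i) = c j i

  module _ (u v : Poly) where
    open ≈ₚ-Reasoning

    -- Agreement is asked only on the diagonal that the form reads. The recurrences of the Lucas
    -- coefficients fail at (0, 0), which lies off every diagonal of positive degree.
    form-cong : ∀ {c c′} n → (∀ j i → j ℕ.+ i ≡.≡ n → c j i ≈ c′ j i) →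
                form u v c n ≈ₚ form u v c′ n
    form-cong zero    c≈c′ = ∷-cong (c≈c′ 0 0 ≡.refl) ≈ₚ-refl
    form-cong (suc n) c≈c′ = +ₚ-cong
      (*ₚ-congˡ u (form-cong n λ j i j+i≡n → c≈c′ (suc j) i (≡.cong suc j+i≡n)))
      (·ₚ-cong (c≈c′ 0 (suc n) ≡.refl) ≈ₚ-refl)

    form-+ : ∀ c c′ n → form u v c n +ₚ form u v c′ n ≈ₚ form u v (λ j i → c j i + c′ j i) n
    form-+ c c′ zero    = ≈ₚ-refl
    form-+ c c′ (suc n) = ≈ₚ-trans
      (+ₚ-interchange (u *ₚ form u v _ n) _ (u *ₚ form u v _ n) _)
      (+ₚ-cong
        (≈ₚ-trans (≈ₚ-sym (*ₚ-distribˡ u (form u v _ n) (form u v _ n))) (*ₚ-congˡ u (form-+ _ _ n)))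
        (≈ₚ-sym (·ₚ-distribʳ (c 0 (suc n)) (c′ 0 (suc n)) (v ^ₚ suc n))))

    *ₚ-form-shiftˡ : ∀ c n → u *ₚ form u v c n ≈ₚ form u v (shiftˡ c) (suc n)
    *ₚ-form-shiftˡ c n = begin
      u *ₚ form u v c n                                 ≈⟨ +ₚ-identityʳ _ ⟨
      u *ₚ form u v c n +ₚ []                           ≈⟨ +ₚ-cong ≈ₚ-refl (·ₚ-zeroˡ (v ^ₚ suc n)) ⟨
      u *ₚ form u v c n +ₚ 0# ·ₚ v ^ₚ suc n             ∎

    *ₚ-form-shiftʳ : ∀ c n → v *ₚ form u v c n ≈ₚ form u v (shiftʳ c) (suc n)
    *ₚ-form-shiftʳ c zero = begin
      v *ₚ const (c 0 0)                                ≈⟨ *ₚ-congˡ v (∷-cong (*-identityʳ _) ≈ₚ-refl) ⟨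
      v *ₚ (c 0 0 ·ₚ const 1#)                          ≈⟨ *ₚ-·ₚ-comm (c 0 0) v (const 1#) ⟩
      c 0 0 ·ₚ v ^ₚ 1                                   ≈⟨ +ₚ-cong (≈ₚ-trans (*ₚ-congˡ u 0∷[]≈[]) (*ₚ-zeroʳ u)) ≈ₚ-refl ⟨
      u *ₚ const 0# +ₚ c 0 0 ·ₚ v ^ₚ 1                  ∎
    *ₚ-form-shiftʳ c (suc n) = begin
      v *ₚ (u *ₚ F +ₚ a ·ₚ v ^ₚ suc n)                  ≈⟨ *ₚ-distribˡ v (u *ₚ F) _ ⟩
      v *ₚ (u *ₚ F) +ₚ v *ₚ (a ·ₚ v ^ₚ suc n)           ≈⟨ +ₚ-cong v[uF]≈u[vF] (*ₚ-·ₚ-comm a v (v ^ₚ suc n)) ⟩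
      u *ₚ (v *ₚ F) +ₚ a ·ₚ v ^ₚ suc (suc n)            ≈⟨ +ₚ-cong (*ₚ-congˡ u (*ₚ-form-shiftʳ (λ j → c (suc j)) n)) ≈ₚ-refl ⟩
      u *ₚ form u v (shiftʳ (λ j → c (suc j))) (suc n) +ₚ a ·ₚ v ^ₚ suc (suc n)
        -- `shiftʳ` inspects its second index, so the two arrays agree only after a case split on
        -- `i`.
        ≈⟨ +ₚ-cong (*ₚ-congˡ u (form-cong {shiftʳ (λ j → c (suc j))} {λ j → shiftʳ c (suc j)} (suc n) λ { j zero _ → refl ; j (suc i) _ → refl })) ≈ₚ-refl ⟩
      form u v (shiftʳ c) (suc (suc n))                 ∎
      where
      F = form u v (λ j → c (suc j)) n
      a = c 0 (suc n)
      v[uF]≈u[vF] : v *ₚ (u *ₚ F) ≈ₚ u *ₚ (v *ₚ F)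
      v[uF]≈u[vF] = begin
        v *ₚ (u *ₚ F) ≈⟨ *ₚ-assoc v u F ⟨
        v *ₚ u *ₚ F   ≈⟨ *ₚ-cong (*ₚ-comm v u) ≈ₚ-refl ⟩
        u *ₚ v *ₚ F   ≈⟨ *ₚ-assoc u v F ⟩
        u *ₚ (v *ₚ F) ∎

open ≡
open ℤ[x]
open PolynomialProperties ℤ.+-*-commutativeSemiring
open HomogeneousForms ℤ.+-*-commutativeSemiring

-- Degrees and orders modulo a prime

coeff-*ₚ-zero : ∀ p q → coeff (p *ₚ q) 0 ≡ coeff p 0 ℤ.* coeff q 0
coeff-*ₚ-zero []      q = refl
coeff-*ₚ-zero (a ∷ p) q = begin
  coeff (a ·ₚ q +ₚ (0ℤ ∷ p *ₚ q)) 0  ≡⟨ coeff-+ₚ (a ·ₚ q) _ 0 ⟩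
  coeff (a ·ₚ q) 0 ℤ.+ 0ℤ            ≡⟨ ℤ.+-identityʳ _ ⟩
  coeff (a ·ₚ q) 0                   ≡⟨ coeff-·ₚ a q 0 ⟩
  a ℤ.* coeff q 0                    ∎
  where open ≡-Reasoning

coeff-*ₚ-suc : ∀ a p q n →
  coeff ((a ∷ p) *ₚ q) (suc n) ≡ a ℤ.* coeff q (suc n) ℤ.+ coeff (p *ₚ q) n
coeff-*ₚ-suc a p q n =
  trans (coeff-+ₚ (a ·ₚ q) _ (suc n)) (cong (ℤ._+ _) (coeff-·ₚ a q (suc n)))

-- Unlike `HasDegree`, this holds of the zero polynomial too, so bounds combine without any proof
-- that a leading coefficient survives.
DegreeAtMost : Poly → ℕ → Set
DegreeAtMost p n = ∀ i → n < i → coeff p i ≡ 0ℤ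

degreeAtMost-≈ : ∀ {p q n} → p ≈ₚ q → DegreeAtMost p n → DegreeAtMost q n
degreeAtMost-≈ p≈q p≤n i n<i = trans (sym (coeff-≈ p≈q i)) (p≤n i n<i)

degreeAtMost-mono : ∀ {p m n} → m ≤ n → DegreeAtMost p m → DegreeAtMost p n
degreeAtMost-mono m≤n p≤m i n<i = p≤m i (ℕ.≤-<-trans m≤n n<i)

degreeAtMost-+ : ∀ p q {n} → DegreeAtMost p n → DegreeAtMost q n → DegreeAtMost (p +ₚ q) n
degreeAtMost-+ p q p≤n q≤n i n<i =
  trans (coeff-+ₚ p q i) (cong₂ ℤ._+_ (p≤n i n<i) (q≤n i n<i))

degreeAtMost-· : ∀ a p {n} → DegreeAtMost p n → DegreeAtMost (a ·ₚ p) n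
degreeAtMost-· a p p≤n i n<i =
  trans (coeff-·ₚ a p i) (trans (cong (a ℤ.*_) (p≤n i n<i)) (ℤ.*-zeroʳ a))

a*0+0≡0 : ∀ a {x y} → x ≡ 0ℤ → y ≡ 0ℤ → a ℤ.* x ℤ.+ y ≡ 0ℤ
a*0+0≡0 a refl refl = trans (ℤ.+-identityʳ _) (ℤ.*-zeroʳ a)

-- A polynomial of degree at most 0 can still carry a tail of zeros; this removes the contribution
-- of that tail to a product.
coeffs≡0⇒*ₚ≈[] : ∀ {p} q → (∀ i → coeff p i ≡ 0ℤ) → p *ₚ q ≈ₚ []
coeffs≡0⇒*ₚ≈[] {p} q p≡0 = *ₚ-cong {p} {[]} {q} {q} (mk≈ₚ p≡0) ≈ₚ-refl

degreeAtMost-* : ∀ p q m n → DegreeAtMost p m → DegreeAtMost q n → DegreeAtMost (p *ₚ q) (m ℕ.+ n)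
degreeAtMost-* []      q m       n p≤m q≤n i       m+n<i = refl
degreeAtMost-* (a ∷ p) q zero    n p≤m q≤n (suc i) n<i =
  trans (coeff-*ₚ-suc a p q i)
    (a*0+0≡0 a (q≤n _ n<i) (coeff-≈ (coeffs≡0⇒*ₚ≈[] {p} q (λ j → p≤m (suc j) (s≤s z≤n))) i))
degreeAtMost-* (a ∷ p) q (suc m) n p≤m q≤n (suc i) (s≤s m+n<i) =
  trans (coeff-*ₚ-suc a p q i)
    (a*0+0≡0 a (q≤n _ (s≤s (ℕ.≤-trans (ℕ.m≤n+m n m) (ℕ.<⇒≤ m+n<i))))
      (degreeAtMost-* p q m n (λ j m<j → p≤m (suc j) (s≤s m<j)) q≤n i m+n<i))

coeff-*ₚ-top : ∀ p q m n → DegreeAtMost p m → DegreeAtMost q n →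
               coeff (p *ₚ q) (m ℕ.+ n) ≡ coeff p m ℤ.* coeff q n
coeff-*ₚ-top []      q m       n       p≤m q≤n = refl
coeff-*ₚ-top (a ∷ p) q zero    zero    p≤m q≤n = coeff-*ₚ-zero (a ∷ p) q
coeff-*ₚ-top (a ∷ p) q zero    (suc n) p≤m q≤n =
  trans (coeff-*ₚ-suc a p q n)
    (trans (cong (ℤ._+_ (a ℤ.* coeff q (suc n))) (coeff-≈ (coeffs≡0⇒*ₚ≈[] {p} q (λ j → p≤m (suc j) (s≤s z≤n))) n))
      (ℤ.+-identityʳ _))
coeff-*ₚ-top (a ∷ p) q (suc m) n       p≤m q≤n =
  trans (coeff-*ₚ-suc a p q (m ℕ.+ n))
    (trans (cong₂ ℤ._+_
             (trans (cong (a ℤ.*_) (q≤n _ (s≤s (ℕ.m≤n+m n m)))) (ℤ.*-zeroʳ a))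
             (coeff-*ₚ-top p q m n (λ j m<j → p≤m (suc j) (s≤s m<j)) q≤n))
      (ℤ.+-identityˡ _))

hasDegree-* : ∀ p q m n → HasDegree p m → HasDegree q n → HasDegree (p *ₚ q) (m ℕ.+ n)
hasDegree-* p q m n (pₘ≢0 , p≤m) (qₙ≢0 , q≤n) =
  (λ eq → [ pₘ≢0 , qₙ≢0 ]′
     (ℤ.i*j≡0⇒i≡0∨j≡0 (coeff p m) (trans (sym (coeff-*ₚ-top p q m n p≤m q≤n)) eq))) ,
  degreeAtMost-* p q m n p≤m q≤n

hasDegree? : ∀ p → (p ≈ₚ []) ⊎ ∃ (HasDegree p)
hasDegree? [] = inj₁ ≈ₚ-refl
hasDegree? (a ∷ p) with hasDegree? p | a ℤ.≟ 0ℤ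
... | inj₂ (n , pₙ≢0 , p≤n) | _       = inj₂ (suc n , pₙ≢0 , λ { (suc i) (s≤s n<i) → p≤n i n<i })
... | inj₁ p≈[]             | yes a≡0 = inj₁ (≈ₚ-trans (∷-cong a≡0 p≈[]) 0∷[]≈[])
... | inj₁ p≈[]             | no  a≢0 = inj₂ (0 , a≢0 , λ { (suc i) _ → coeff-≈ p≈[] i })

degree-≤ : ∀ p {m n} → HasDegree p m → DegreeAtMost p n → m ≤ n
degree-≤ p (pₘ≢0 , _) p≤n = ℕ.≮⇒≥ λ n<m → pₘ≢0 (p≤n _ n<m)

·ₚ-cancelˡ : ∀ c .{{_ : ℤ.NonZero c}} {p r} → c ·ₚ p ≈ₚ c ·ₚ r → p ≈ₚ r
·ₚ-cancelˡ c {p} {r} eq = mk≈ₚ λ n → ℤ.*-cancelˡ-≡ c _ _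
  (trans (sym (coeff-·ₚ c p n)) (trans (coeff-≈ eq n) (coeff-·ₚ c r n)))

hasDegree-· : ∀ c .{{_ : ℤ.NonZero c}} p {r n} → r ≈ₚ c ·ₚ p → HasDegree p n → HasDegree r n
hasDegree-· c p {r} {n} eq (pₙ≢0 , p≤n) =
  (λ rₙ≡0 → [ (λ c≡0 → ℕ.≢-nonZero⁻¹ ℤ.∣ c ∣ (cong ℤ.∣_∣ c≡0)) , pₙ≢0 ]′
    (ℤ.i*j≡0⇒i≡0∨j≡0 c (trans (sym (coeff-·ₚ c p n)) (trans (sym (coeff-≈ eq n)) rₙ≡0)))) ,
  degreeAtMost-≈ (≈ₚ-sym eq) (degreeAtMost-· c p p≤n)

module _ {q : ℕ} (q-prime : Prime q) where

  private instance
    q≢0 : NonZero q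
    q≢0 = prime⇒nonZero q-prime

  euclid : ∀ x y → + q ∣ₛ x ℤ.* y → + q ∣ₛ x ⊎ + q ∣ₛ y
  euclid x y q∣xy = ⊎.map ∣ᵤ⇒∣ ∣ᵤ⇒∣
    (euclidsLemma ℤ.∣ x ∣ ℤ.∣ y ∣ q-prime (subst (q ℕ.∣_) (ℤ.abs-* x y) (∣⇒∣ᵤ q∣xy)))

  VanishesBelow : Poly → ℕ → Set
  VanishesBelow p n = ∀ i → i < n → + q ∣ₛ coeff p i

  -- The reduction of p modulo q is xⁿ times a polynomial with non-zero constant term.
  HasOrder : Poly → ℕ → Set
  HasOrder p n = VanishesBelow p n × ¬ (+ q ∣ₛ coeff p n)

  ∣0 : + q ∣ₛ 0ℤ
  ∣0 = divides 0ℤ refl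

  vanishesBelow-* : ∀ p r m n → VanishesBelow p m → VanishesBelow r n → VanishesBelow (p *ₚ r) (m ℕ.+ n)
  vanishesBelow-* []      r m       n p<m r<n i       i<m+n = ∣0
  vanishesBelow-* (a ∷ p) r zero    n p<m r<n zero    i<n   =
    subst (+ q ∣ₛ_) (sym (coeff-*ₚ-zero (a ∷ p) r)) (∣n⇒∣m*n a (r<n 0 i<n))
  vanishesBelow-* (a ∷ p) r zero    n p<m r<n (suc i) i<n   =
    subst (+ q ∣ₛ_) (sym (coeff-*ₚ-suc a p r i))
      (∣m∣n⇒∣m+n (∣n⇒∣m*n a (r<n (suc i) i<n))
        (vanishesBelow-* p r 0 n (λ _ ()) r<n i (ℕ.<-trans (ℕ.n<1+n i) i<n)))
  vanishesBelow-* (a ∷ p) r (suc m) n p<m r<n zero    _     =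
    subst (+ q ∣ₛ_) (sym (coeff-*ₚ-zero (a ∷ p) r)) (∣m⇒∣m*n _ (p<m 0 (s≤s z≤n)))
  vanishesBelow-* (a ∷ p) r (suc m) n p<m r<n (suc i) (s≤s i<m+n) =
    subst (+ q ∣ₛ_) (sym (coeff-*ₚ-suc a p r i))
      (∣m∣n⇒∣m+n (∣m⇒∣m*n _ (p<m 0 (s≤s z≤n)))
        (vanishesBelow-* p r m n (λ j j<m → p<m (suc j) (s≤s j<m)) r<n i i<m+n))

  -- Any other product of coefficients at indices i and j with i + j = m + n has i < m or j < n,
  -- hence is a multiple of q. With `euclid` this makes orders additive, which is Gauss' lemma
  -- modulo q.
  ∣coeff-*ₚ⇒∣* : ∀ p r m n → VanishesBelow p m → VanishesBelow r n →
                 + q ∣ₛ coeff (p *ₚ r) (m ℕ.+ n) → + q ∣ₛ coeff p m ℤ.* coeff r n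
  ∣coeff-*ₚ⇒∣* []      r m       n       p<m r<n q∣ = ∣0
  ∣coeff-*ₚ⇒∣* (a ∷ p) r zero    zero    p<m r<n q∣ =
    subst (+ q ∣ₛ_) (coeff-*ₚ-zero (a ∷ p) r) q∣
  ∣coeff-*ₚ⇒∣* (a ∷ p) r zero    (suc n) p<m r<n q∣ =
    ∣m+n∣n⇒∣m (subst (+ q ∣ₛ_) (coeff-*ₚ-suc a p r n) q∣)
      (vanishesBelow-* p r 0 (suc n) (λ _ ()) r<n n (ℕ.n<1+n n))
  ∣coeff-*ₚ⇒∣* (a ∷ p) r (suc m) n       p<m r<n q∣ =
    ∣coeff-*ₚ⇒∣* p r m n (λ j j<m → p<m (suc j) (s≤s j<m)) r<n
      (∣m+n∣m⇒∣n (subst (+ q ∣ₛ_) (coeff-*ₚ-suc a p r (m ℕ.+ n)) q∣)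
        (∣m⇒∣m*n _ (p<m 0 (s≤s z≤n))))

  hasOrder-* : ∀ p r {m n} → HasOrder p m → HasOrder r n → HasOrder (p *ₚ r) (m ℕ.+ n)
  hasOrder-* p r {m} {n} (p<m , q∤pₘ) (r<n , q∤rₙ) =
    vanishesBelow-* p r m n p<m r<n ,
    λ q∣ → [ q∤pₘ , q∤rₙ ]′ (euclid _ _ (∣coeff-*ₚ⇒∣* p r m n p<m r<n q∣))

  hasOrder-≈ : ∀ {p r n} → p ≈ₚ r → HasOrder p n → HasOrder r n
  hasOrder-≈ p≈r (p<n , q∤pₙ) =
    (λ i i<n → subst (+ q ∣ₛ_) (coeff-≈ p≈r i) (p<n i i<n)) ,
    λ q∣ → q∤pₙ (subst (+ q ∣ₛ_) (sym (coeff-≈ p≈r _)) q∣)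

  hasOrder-+ : ∀ p r {n} → HasOrder p n → (∀ i → + q ∣ₛ coeff r i) → HasOrder (p +ₚ r) n
  hasOrder-+ p r {n} (p<n , q∤pₙ) q∣r =
    (λ i i<n → subst (+ q ∣ₛ_) (sym (coeff-+ₚ p r i)) (∣m∣n⇒∣m+n (p<n i i<n) (q∣r i))) ,
    λ q∣ → q∤pₙ (∣m+n∣n⇒∣m (subst (+ q ∣ₛ_) (coeff-+ₚ p r n) q∣) (q∣r n))

  hasOrder-unique : ∀ {p m n} → HasOrder p m → HasOrder p n → m ≡ n
  hasOrder-unique {p} {m} {n} (p<m , q∤pₘ) (p<n , q∤pₙ) with ℕ.<-cmp m n
  ... | tri< m<n _ _ = contradiction (p<n m m<n) q∤pₘ
  ... | tri≈ _ m≡n _ = m≡n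
  ... | tri> _ _ n<m = contradiction (p<m n n<m) q∤pₙ

  hasOrder? : ∀ p → (∀ i → + q ∣ₛ coeff p i) ⊎ ∃ (HasOrder p)
  hasOrder? []      = inj₁ λ _ → ∣0
  hasOrder? (a ∷ p) with + q ∣? a | hasOrder? p
  ... | no  q∤a | _                       = inj₂ (0 , (λ _ ()) , q∤a)
  ... | yes q∣a | inj₁ q∣p                = inj₁ λ { zero → q∣a ; (suc i) → q∣p i }
  ... | yes q∣a | inj₂ (n , p<n , q∤pₙ)   =
    inj₂ (suc n , (λ { zero _ → q∣a ; (suc i) (s≤s i<n) → p<n i i<n }) , q∤pₙ)

  ∣coeffs-* : ∀ p r → (∀ i → + q ∣ₛ coeff p i) → ∀ i → + q ∣ₛ coeff (p *ₚ r) i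
  -- A polynomial that is zero modulo q vanishes below every index; `suc i` is just enough to reach
  -- `i`.
  ∣coeffs-* p r q∣p i = vanishesBelow-* p r (suc i) 0 (λ j _ → q∣p j) (λ _ ()) i
    (ℕ.m≤m+n (suc i) 0)

  order≤degree : ∀ p {m n} → HasOrder p m → DegreeAtMost p n → m ≤ n
  order≤degree p (_ , q∤pₘ) p≤n = ℕ.≮⇒≥ λ n<m → q∤pₘ (subst (+ q ∣ₛ_) (sym (p≤n _ n<m)) ∣0)

  -- Eisenstein's criterion for factorisations in ℤ[x]

  record Eisenstein (f : Poly) (n : ℕ) : Set where
    field
      1≤n       : 1 ≤ n
      -- Together with `degree≤n` this is the usual hypothesis: q divides all coefficients but the
      -- leading one, which sits at `n`.
      order     : HasOrder f n
      degree≤n  : DegreeAtMost f n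
      q²∤f₀     : ¬ (+ q ℤ.* + q ∣ₛ coeff f 0)

  -- The orders r, s of the factors add up to n, their degrees r′, s′ to at most n, and r ≤ r′, s ≤
  -- s′; so order and degree coincide for each factor. If r and s were both positive, q would divide
  -- both constant terms and q² that of f.
  eisenstein-split : ∀ {f n} x y → Eisenstein f n → x *ₚ y ≈ₚ f → HasDegree x 0 ⊎ HasDegree y 0
  eisenstein-split {f} {n} x y E xy≈f =
    split (hasOrder? x) (hasOrder? y) (hasDegree? x) (hasDegree? y)
    where
    open Eisenstein E
    q∤f : ¬ (∀ i → + q ∣ₛ coeff (x *ₚ y) i)
    q∤f q∣ = proj₂ order (subst (+ q ∣ₛ_) (coeff-≈ xy≈f n) (q∣ n))

    split : (∀ i → + q ∣ₛ coeff x i) ⊎ ∃ (HasOrder x) → (∀ i → + q ∣ₛ coeff y i) ⊎ ∃ (HasOrder y) →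
            (x ≈ₚ []) ⊎ ∃ (HasDegree x) → (y ≈ₚ []) ⊎ ∃ (HasDegree y) → HasDegree x 0 ⊎ HasDegree y 0
    split (inj₁ q∣x) _ _ _ = contradiction (∣coeffs-* x y q∣x) q∤f
    split _ (inj₁ q∣y) _ _ = contradiction
      (λ i → subst (+ q ∣ₛ_) (coeff-≈ (*ₚ-comm y x) i) (∣coeffs-* y x q∣y i)) q∤f
    split (inj₂ (m , _ , q∤xₘ)) _ (inj₁ x≈[]) _ =
      contradiction (subst (+ q ∣ₛ_) (sym (coeff-≈ x≈[] m)) ∣0) q∤xₘ
    split _ (inj₂ (m , _ , q∤yₘ)) _ (inj₁ y≈[]) =
      contradiction (subst (+ q ∣ₛ_) (sym (coeff-≈ y≈[] m)) ∣0) q∤yₘ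
    split (inj₂ (r , xr)) (inj₂ (s , ys)) (inj₂ (r′ , dx)) (inj₂ (s′ , dy)) = conclude r s xr ys r≡r′ s≡s′
      where
      r+s≡n : r ℕ.+ s ≡ n
      r+s≡n = hasOrder-unique {f} (hasOrder-≈ xy≈f (hasOrder-* x y xr ys)) order
      r≤r′ : r ≤ r′
      r≤r′ = order≤degree x xr (proj₂ dx)
      s≤s′ : s ≤ s′
      s≤s′ = order≤degree y ys (proj₂ dy)
      r′+s′≤r+s : r′ ℕ.+ s′ ≤ r ℕ.+ s
      r′+s′≤r+s = subst (r′ ℕ.+ s′ ≤_) (sym r+s≡n)
        (degree-≤ (x *ₚ y) (hasDegree-* x y r′ s′ dx dy) (degreeAtMost-≈ (≈ₚ-sym xy≈f) degree≤n))
      r≡r′ : r ≡ r′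
      r≡r′ = ℕ.≤-antisym r≤r′
        (ℕ.+-cancelʳ-≤ s r′ r (ℕ.≤-trans (ℕ.+-monoʳ-≤ r′ s≤s′) r′+s′≤r+s))
      s≡s′ : s ≡ s′
      s≡s′ = ℕ.≤-antisym s≤s′
        (ℕ.+-cancelˡ-≤ r s′ s (ℕ.≤-trans (ℕ.+-monoˡ-≤ s′ r≤r′) r′+s′≤r+s))
      conclude : ∀ r s → HasOrder x r → HasOrder y s → r ≡ r′ → s ≡ s′ → HasDegree x 0 ⊎ HasDegree y 0
      conclude zero    s       _         _         refl _    = inj₁ dx
      conclude (suc r) zero    _         _         _    refl = inj₂ dy
      conclude (suc r) (suc s) (x<r , _) (y<s , _) _    _    = contradiction q²∣f₀ q²∤f₀
        where
        q²∣f₀ : + q ℤ.* + q ∣ₛ coeff f 0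
        q²∣f₀ = subst (+ q ℤ.* + q ∣ₛ_) (trans (sym (coeff-*ₚ-zero x y)) (coeff-≈ xy≈f 0))
          (∣-trans (*-monoʳ-∣ (+ q) (y<s 0 (s≤s z≤n))) (*-monoˡ-∣ (coeff y 0) (x<r 0 (s≤s z≤n))))

  ∣coeffs⇒multiple : ∀ p → (∀ i → + q ∣ₛ coeff p i) → ∃ λ r → p ≈ₚ + q ·ₚ r
  ∣coeffs⇒multiple []      q∣p = [] , ≈ₚ-refl
  ∣coeffs⇒multiple (a ∷ p) q∣p with q∣p 0 | ∣coeffs⇒multiple p (λ i → q∣p (suc i))
  ... | divides b a≡b*q | r , p≈qr = b ∷ r , ∷-cong (trans a≡b*q (ℤ.*-comm b (+ q))) p≈qr

  eisenstein-· : ∀ {f n} c → ¬ (q ℕ.∣ c) → Eisenstein f n → Eisenstein (+ c ·ₚ f) n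
  eisenstein-· {f} {n} c q∤c E = record
    { 1≤n      = 1≤n
    ; order    = (λ i i<n → subst (+ q ∣ₛ_) (sym (coeff-·ₚ (+ c) f i)) (∣n⇒∣m*n (+ c) (proj₁ order i i<n))) ,
                 λ q∣ → [ (λ q∣c → q∤c (∣⇒∣ᵤ q∣c)) , proj₂ order ]′
                          (euclid (+ c) _ (subst (+ q ∣ₛ_) (coeff-·ₚ (+ c) f n) q∣))
    ; degree≤n = degreeAtMost-· (+ c) f degree≤n
    ; q²∤f₀    = q²∤cf₀
    }
    where
    open Eisenstein E
    q²∤cf₀ : ¬ (+ q ℤ.* + q ∣ₛ coeff (+ c ·ₚ f) 0)
    -- As 1 ≤ n, the constant term of f is b q. Cancelling one q from q² ∣ c b q leaves q ∣ c b, to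
    -- which primality applies.
    q²∤cf₀ q²∣cf₀ with proj₁ order 0 1≤n
    ... | divides b f₀≡bq with euclid (+ c) b (*-cancelʳ-∣ (+ q) (subst (+ q ℤ.* + q ∣ₛ_) cf₀≡cbq q²∣cf₀))
      where
      cf₀≡cbq : coeff (+ c ·ₚ f) 0 ≡ + c ℤ.* b ℤ.* + q
      cf₀≡cbq = trans (coeff-·ₚ (+ c) f 0)
        (trans (cong (+ c ℤ.*_) f₀≡bq) (sym (ℤ.*-assoc (+ c) b (+ q))))
    ... | inj₁ q∣c = q∤c (∣⇒∣ᵤ q∣c)
    ... | inj₂ q∣b = q²∤f₀ (subst (+ q ℤ.* + q ∣ₛ_) (sym f₀≡bq) (*-monoˡ-∣ (+ q) q∣b))

  -- Factors q of c can be moved into x or y by Gauss' lemma modulo q; the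
  -- remaining scalar keeps the Eisenstein property.
  eisenstein-split-· : ∀ {f n} → Eisenstein f n → ∀ c .{{_ : NonZero c}} x y →
                       x *ₚ y ≈ₚ + c ·ₚ f → HasDegree x 0 ⊎ HasDegree y 0
  eisenstein-split-· {f} {n} E c {{c≢0}} = <-rec Splits step c c≢0
    where
    Splits : ℕ → Set
    Splits c = .(NonZero c) → ∀ x y → x *ₚ y ≈ₚ + c ·ₚ f → HasDegree x 0 ⊎ HasDegree y 0

    step : ∀ c → (∀ {c′} → c′ < c → Splits c′) → Splits c
    step c rec c≢0 x y xy≈cf with q ℕ.∣? c
    ... | no  q∤c = eisenstein-split x y (eisenstein-· c q∤c E) xy≈cf
    ... | yes (ℕ.divides c′ refl) = split (hasOrder? x) (hasOrder? y)
      where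
      instance
        c′≢0 : NonZero c′
        c′≢0 = ℕ.m*n≢0⇒m≢0 c′ {{c≢0}}

      c′<c : c′ < c′ ℕ.* q
      c′<c = ℕ.m<m*n c′ q (ℕ.nonTrivial⇒n>1 q {{prime⇒nonTrivial q-prime}})

      q·c′f : + (c′ ℕ.* q) ·ₚ f ≈ₚ + q ·ₚ (+ c′ ·ₚ f)
      q·c′f = ≈ₚ-trans
        (·ₚ-cong (trans (cong +_ (ℕ.*-comm c′ q)) (ℤ.pos-* q c′)) (≈ₚ-refl {f}))
        (≈ₚ-sym (·ₚ-assoc (+ q) (+ c′) f))

      divide : ∀ x y → x *ₚ y ≈ₚ + (c′ ℕ.* q) ·ₚ f → (∀ i → + q ∣ₛ coeff x i) → HasDegree x 0 ⊎ HasDegree y 0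
      divide x y xy≈cf q∣x with ∣coeffs⇒multiple x q∣x
      -- One factor q cancels from the equation, and degree 0 passes back from `x′` to its non-zero
      -- multiple `x`.
      ... | x′ , x≈qx′ = ⊎.map₁ (hasDegree-· (+ q) x′ x≈qx′)
        (rec c′<c c′≢0 x′ y (·ₚ-cancelˡ (+ q) (begin
          + q ·ₚ (x′ *ₚ y)     ≈⟨ ·ₚ-*ₚ-assoc (+ q) x′ y ⟨
          (+ q ·ₚ x′) *ₚ y     ≈⟨ *ₚ-cong x≈qx′ (≈ₚ-refl {y}) ⟨
          x *ₚ y               ≈⟨ xy≈cf ⟩
          + (c′ ℕ.* q) ·ₚ f    ≈⟨ q·c′f ⟩
          + q ·ₚ (+ c′ ·ₚ f)   ∎)))
        where open ≈ₚ-Reasoning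

      split : (∀ i → + q ∣ₛ coeff x i) ⊎ ∃ (HasOrder x) → (∀ i → + q ∣ₛ coeff y i) ⊎ ∃ (HasOrder y) →
              HasDegree x 0 ⊎ HasDegree y 0
      split (inj₁ q∣x) _ = divide x y xy≈cf q∣x
      split _ (inj₁ q∣y) = ⊎.swap (divide y x (≈ₚ-trans (*ₚ-comm y x) xy≈cf) q∣y)
      -- Neither factor vanishes modulo q, so q does not divide the coefficient of x y at r + s,
      -- although x y is q times `+ c′ ·ₚ f`.
      split (inj₂ (r , xr)) (inj₂ (s , ys)) = contradiction
        (subst (+ q ∣ₛ_) (sym (trans (coeff-≈ (≈ₚ-trans xy≈cf q·c′f) (r ℕ.+ s)) (coeff-·ₚ (+ q) (+ c′ ·ₚ f) (r ℕ.+ s))))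
          (∣m⇒∣m*n _ ∣-refl))
        (proj₂ (hasOrder-* x y xr ys))

-- From ℤ[x] to ℚ[x]

module ℚₚ = PolynomialProperties (CommutativeRing.commutativeSemiring ℚ.+-*-commutativeRing)

fromℤ : ℤ → ℚ
fromℤ z = z ℚ./ 1

-- Division in ℚ normalises by a gcd and is stuck on a variable. Among unnormalised rationals an
-- integer simply has denominator 1, and the homomorphism laws below reduce to integer identities.
toℚᵘ-fromℤ : ∀ z → toℚᵘ (fromℤ z) ℚᵘ.≃ mkℚᵘ z 0
toℚᵘ-fromℤ z = ℚ.toℚᵘ-fromℚᵘ (mkℚᵘ z 0)

fromℤ-injective : ∀ {x y} → fromℤ x ≡ fromℤ y → x ≡ y
fromℤ-injective {x} {y} eq with ℚ.fromℚᵘ-injective {mkℚᵘ x 0} {mkℚᵘ y 0} eq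
... | *≡* x*1≡y*1 = trans (sym (ℤ.*-identityʳ x)) (trans x*1≡y*1 (ℤ.*-identityʳ y))

fromℤ-homo-+ : ∀ x y → fromℤ (x ℤ.+ y) ≡ fromℤ x ℚ.+ fromℤ y
fromℤ-homo-+ x y = ℚ.toℚᵘ-injective (begin
  toℚᵘ (fromℤ (x ℤ.+ y))             ≈⟨ toℚᵘ-fromℤ (x ℤ.+ y) ⟩
  mkℚᵘ (x ℤ.+ y) 0                   ≈⟨ *≡* (cong (ℤ._* 1ℤ) (cong₂ ℤ._+_ (ℤ.*-identityʳ x) (ℤ.*-identityʳ y))) ⟨
  mkℚᵘ x 0 ℚᵘ.+ mkℚᵘ y 0             ≈⟨ ℚᵘ.+-cong (toℚᵘ-fromℤ x) (toℚᵘ-fromℤ y) ⟨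
  toℚᵘ (fromℤ x) ℚᵘ.+ toℚᵘ (fromℤ y) ≈⟨ ℚ.toℚᵘ-homo-+ (fromℤ x) (fromℤ y) ⟨
  toℚᵘ (fromℤ x ℚ.+ fromℤ y)         ∎)
  where open SetoidReasoning ℚᵘ.≃-setoid

fromℤ-homo-* : ∀ x y → fromℤ (x ℤ.* y) ≡ fromℤ x ℚ.* fromℤ y
fromℤ-homo-* x y = ℚ.toℚᵘ-injective (begin
  toℚᵘ (fromℤ (x ℤ.* y))             ≈⟨ toℚᵘ-fromℤ (x ℤ.* y) ⟩
  mkℚᵘ x 0 ℚᵘ.* mkℚᵘ y 0             ≈⟨ ℚᵘ.*-cong (toℚᵘ-fromℤ x) (toℚᵘ-fromℤ y) ⟨
  toℚᵘ (fromℤ x) ℚᵘ.* toℚᵘ (fromℤ y) ≈⟨ ℚ.toℚᵘ-homo-* (fromℤ x) (fromℤ y) ⟨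
  toℚᵘ (fromℤ x ℚ.* fromℤ y)         ∎)
  where open SetoidReasoning ℚᵘ.≃-setoid

fromℤ-↧*≡↥ : ∀ r → fromℤ (ℚ.↧ r) ℚ.* r ≡ fromℤ (ℚ.↥ r)
fromℤ-↧*≡↥ r@(mkℚ n d-1 _) = ℚ.toℚᵘ-injective (begin
  toℚᵘ (fromℤ d ℚ.* r)               ≈⟨ ℚ.toℚᵘ-homo-* (fromℤ d) r ⟩
  toℚᵘ (fromℤ d) ℚᵘ.* mkℚᵘ n d-1     ≈⟨ ℚᵘ.*-cong (toℚᵘ-fromℤ d) ℚᵘ.≃-refl ⟩
  mkℚᵘ d 0 ℚᵘ.* mkℚᵘ n d-1           ≈⟨ *≡* (trans (ℤ.*-identityʳ _) (trans (ℤ.*-comm d n) (cong (λ k → n ℤ.* + suc k) (sym (ℕ.+-identityʳ d-1))))) ⟩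
  mkℚᵘ n 0                           ≈⟨ toℚᵘ-fromℤ n ⟨
  toℚᵘ (fromℤ n)                     ∎)
  where
  d = ℚ.↧ r
  open SetoidReasoning ℚᵘ.≃-setoid

open ℚ[x] using () renaming (Poly to ℚPoly; _≈ₚ_ to _≈ℚ_; _*ₚ_ to _*ℚ_; _+ₚ_ to _+ℚ_; _·ₚ_ to _·ℚ_; coeff to coeffℚ; mk≈ₚ to mk≈ℚ; const to constℚ)

ι : Poly → ℚPoly
ι = ℤ[x]→ℚ[x]

coeff-ι : ∀ p n → coeffℚ (ι p) n ≡ fromℤ (coeff p n)
coeff-ι []      n       = refl
coeff-ι (a ∷ p) zero    = refl
coeff-ι (a ∷ p) (suc n) = coeff-ι p n

ι-cong : ∀ {p q} → p ≈ₚ q → ι p ≈ℚ ι q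
ι-cong {p} {q} p≈q = mk≈ℚ λ n →
  trans (coeff-ι p n) (trans (cong fromℤ (coeff-≈ p≈q n)) (sym (coeff-ι q n)))

ι-injective : ∀ {p q} → ι p ≈ℚ ι q → p ≈ₚ q
ι-injective {p} {q} eq = mk≈ₚ λ n → fromℤ-injective
  (trans (sym (coeff-ι p n)) (trans (ℚₚ.coeff-≈ eq n) (coeff-ι q n)))

ι-homo-+ : ∀ p q → ι (p +ₚ q) ≈ℚ ι p +ℚ ι q
ι-homo-+ p q = mk≈ℚ λ n → begin
  coeffℚ (ι (p +ₚ q)) n                        ≡⟨ coeff-ι (p +ₚ q) n ⟩
  fromℤ (coeff (p +ₚ q) n)                     ≡⟨ cong fromℤ (coeff-+ₚ p q n) ⟩
  fromℤ (coeff p n ℤ.+ coeff q n)              ≡⟨ fromℤ-homo-+ (coeff p n) (coeff q n) ⟩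
  fromℤ (coeff p n) ℚ.+ fromℤ (coeff q n)      ≡⟨ cong₂ ℚ._+_ (coeff-ι p n) (coeff-ι q n) ⟨
  coeffℚ (ι p) n ℚ.+ coeffℚ (ι q) n            ≡⟨ ℚₚ.coeff-+ₚ (ι p) (ι q) n ⟨
  coeffℚ (ι p +ℚ ι q) n                        ∎
  where open ≡-Reasoning

ι-homo-· : ∀ a p → ι (a ·ₚ p) ≈ℚ fromℤ a ·ℚ ι p
ι-homo-· a p = mk≈ℚ λ n → begin
  coeffℚ (ι (a ·ₚ p)) n                        ≡⟨ coeff-ι (a ·ₚ p) n ⟩
  fromℤ (coeff (a ·ₚ p) n)                     ≡⟨ cong fromℤ (coeff-·ₚ a p n) ⟩
  fromℤ (a ℤ.* coeff p n)                      ≡⟨ fromℤ-homo-* a (coeff p n) ⟩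
  fromℤ a ℚ.* fromℤ (coeff p n)                ≡⟨ cong (fromℤ a ℚ.*_) (coeff-ι p n) ⟨
  fromℤ a ℚ.* coeffℚ (ι p) n                   ≡⟨ ℚₚ.coeff-·ₚ (fromℤ a) (ι p) n ⟨
  coeffℚ (fromℤ a ·ℚ ι p) n                    ∎
  where open ≡-Reasoning

ι-homo-* : ∀ p q → ι (p *ₚ q) ≈ℚ ι p *ℚ ι q
ι-homo-* []      q = ℚₚ.≈ₚ-refl
ι-homo-* (a ∷ p) q = ℚₚ.≈ₚ-trans (ι-homo-+ (a ·ₚ q) (0ℤ ∷ p *ₚ q))
  (ℚₚ.+ₚ-cong (ι-homo-· a q) (ℚₚ.∷-cong refl (ι-homo-* p q)))

-- `M` need not be the least common denominator: `eisenstein-split-·` accepts every positive scalar,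
-- so the product of all denominators serves.
record IntegralMultiple (x : ℚPoly) : Set where
  field
    M        : ℕ
    M≢0   : NonZero M
    X        : Poly
    M·x≈X    : fromℤ (+ M) ·ℚ x ≈ℚ ι X

integralMultiple : ∀ x → IntegralMultiple x
integralMultiple []      = record { M = 1 ; X = [] ; M·x≈X = ℚₚ.≈ₚ-refl }
integralMultiple (r ∷ x) = record
  { M     = M ℕ.* d
  ; M≢0   = ℕ.m*n≢0 M d {{M≢0}}
  ; X     = (+ M ℤ.* ℚ.↥ r) ∷ (+ d ·ₚ X)
  ; M·x≈X = ℚₚ.∷-cong head tail
  }
  where
  open IntegralMultiple (integralMultiple x)
  d = ℚ.↧ₙ r
  Md : fromℤ (+ (M ℕ.* d)) ≡ fromℤ (+ M) ℚ.* fromℤ (+ d)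
  Md = trans (cong fromℤ (ℤ.pos-* M d)) (fromℤ-homo-* (+ M) (+ d))

  head : fromℤ (+ (M ℕ.* d)) ℚ.* r ≡ fromℤ (+ M ℤ.* ℚ.↥ r)
  head = begin
    fromℤ (+ (M ℕ.* d)) ℚ.* r            ≡⟨ cong (ℚ._* r) Md ⟩
    fromℤ (+ M) ℚ.* fromℤ (+ d) ℚ.* r    ≡⟨ ℚ.*-assoc (fromℤ (+ M)) (fromℤ (+ d)) r ⟩
    fromℤ (+ M) ℚ.* (fromℤ (+ d) ℚ.* r)  ≡⟨ cong (fromℤ (+ M) ℚ.*_) (fromℤ-↧*≡↥ r) ⟩
    fromℤ (+ M) ℚ.* fromℤ (ℚ.↥ r)        ≡⟨ fromℤ-homo-* (+ M) (ℚ.↥ r) ⟨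
    fromℤ (+ M ℤ.* ℚ.↥ r)                ∎
    where open ≡-Reasoning

  tail : fromℤ (+ (M ℕ.* d)) ·ℚ x ≈ℚ ι (+ d ·ₚ X)
  tail = begin
    fromℤ (+ (M ℕ.* d)) ·ℚ x                  ≈⟨ ℚₚ.·ₚ-cong (trans Md (ℚ.*-comm (fromℤ (+ M)) (fromℤ (+ d)))) ℚₚ.≈ₚ-refl ⟩
    (fromℤ (+ d) ℚ.* fromℤ (+ M)) ·ℚ x        ≈⟨ ℚₚ.·ₚ-assoc (fromℤ (+ d)) (fromℤ (+ M)) x ⟨
    fromℤ (+ d) ·ℚ (fromℤ (+ M) ·ℚ x)         ≈⟨ ℚₚ.·ₚ-congˡ (fromℤ (+ d)) M·x≈X ⟩
    fromℤ (+ d) ·ℚ ι X                        ≈⟨ ι-homo-· (+ d) X ⟨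
    ι (+ d ·ₚ X)                              ∎
    where open ℚₚ.≈ₚ-Reasoning

-- Since M y is a non-zero constant X₀, the inverse of y is M / X₀.
integralMultiple-unit : ∀ {y} (I : IntegralMultiple y) → HasDegree (IntegralMultiple.X I) 0 →
                        y ℚ[x].∣ₚ constℚ 1ℚ
integralMultiple-unit {y} I (Y₀≢0 , Y≤0) = constℚ (r ℚ.* m) , (begin
  constℚ (r ℚ.* m) *ℚ y                 ≈⟨ ℚₚ.+ₚ-cong ℚₚ.≈ₚ-refl ℚₚ.0∷[]≈[] ⟩
  (r ℚ.* m) ·ℚ y +ℚ []                  ≈⟨ ℚₚ.+ₚ-identityʳ _ ⟩
  (r ℚ.* m) ·ℚ y                        ≈⟨ ℚₚ.·ₚ-assoc r m y ⟨
  r ·ℚ (m ·ℚ y)                         ≈⟨ ℚₚ.·ₚ-congˡ r (ℚₚ.≈ₚ-trans M·x≈X (ι-cong X≈constX₀)) ⟩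
  r ·ℚ constℚ (fromℤ (coeff X 0))       ≈⟨ ℚₚ.∷-cong (ℚ.*-inverseˡ (fromℤ (coeff X 0))) ℚₚ.≈ₚ-refl ⟩
  constℚ 1ℚ                             ∎)
  where
  open IntegralMultiple I
  open ℚₚ.≈ₚ-Reasoning
  instance
    _ : ℚ.NonZero (fromℤ (coeff X 0))
    _ = ℚ.≢-nonZero λ eq → Y₀≢0 (fromℤ-injective eq)
  m = fromℤ (+ M)
  r = ℚ.1/ fromℤ (coeff X 0)
  X≈constX₀ : X ≈ₚ const (coeff X 0)
  X≈constX₀ = mk≈ₚ λ { zero → refl ; (suc n) → Y≤0 (suc n) (s≤s z≤n) }

·-*-interchange : ∀ a b p r → (a ·ℚ p) *ℚ (b ·ℚ r) ≈ℚ (a ℚ.* b) ·ℚ (p *ℚ r)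
·-*-interchange a b p r = begin
  (a ·ℚ p) *ℚ (b ·ℚ r)   ≈⟨ ℚₚ.·ₚ-*ₚ-assoc a p (b ·ℚ r) ⟩
  a ·ℚ (p *ℚ (b ·ℚ r))   ≈⟨ ℚₚ.·ₚ-congˡ a (ℚₚ.*ₚ-·ₚ-comm b p r) ⟩
  a ·ℚ (b ·ℚ (p *ℚ r))   ≈⟨ ℚₚ.·ₚ-assoc a b (p *ℚ r) ⟩
  (a ℚ.* b) ·ℚ (p *ℚ r)  ∎
  where open ℚₚ.≈ₚ-Reasoning

-- Clearing denominators turns both clauses of irreducibility into statements on degrees in ℤ[x]: h
-- f = 1 would give a multiple of f that is a non-zero constant, against 1 ≤ n, and f = x y gives
-- integral multiples X, Y of which one has degree 0, so that x or y is a unit over ℚ.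
eisenstein-criterion : ∀ {q} (q-prime : Prime q) {f n} → Eisenstein q-prime f n → IrreducibleOverℚ f
eisenstein-criterion q-prime {f} {n} E = record { p∤1 = f∤1 ; split-∣1 = split }
  where
  open Eisenstein E
  f-degree : HasDegree f n
  f-degree = (λ fₙ≡0 → proj₂ order (subst (_ ∣ₛ_) (sym fₙ≡0) (∣0 q-prime))) , degree≤n

  f∤1 : ¬ (ι f ℚ[x].∣ₚ constℚ 1ℚ)
  f∤1 (h , hf≈1) = [ H≉[] , H-degree ]′ (hasDegree? X)
    where
    open IntegralMultiple (integralMultiple h)
    Hf≈M : X *ₚ f ≈ₚ const (+ M)
    Hf≈M = ι-injective (begin
      ι (X *ₚ f)                       ≈⟨ ι-homo-* X f ⟩
      ι X *ℚ ι f                       ≈⟨ ℚₚ.*ₚ-cong M·x≈X ℚₚ.≈ₚ-refl ⟨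
      (fromℤ (+ M) ·ℚ h) *ℚ ι f        ≈⟨ ℚₚ.·ₚ-*ₚ-assoc (fromℤ (+ M)) h (ι f) ⟩
      fromℤ (+ M) ·ℚ (h *ℚ ι f)        ≈⟨ ℚₚ.·ₚ-congˡ (fromℤ (+ M)) hf≈1 ⟩
      constℚ (fromℤ (+ M) ℚ.* 1ℚ)      ≈⟨ ℚₚ.∷-cong (ℚ.*-identityʳ (fromℤ (+ M))) ℚₚ.≈ₚ-refl ⟩
      ι (const (+ M))                  ∎)
      where open ℚₚ.≈ₚ-Reasoning
    H≉[] : ¬ (X ≈ₚ [])
    H≉[] X≈[] = ℕ.≢-nonZero⁻¹ M {{M≢0}} (ℤ.+-injective (trans (sym (coeff-≈ Hf≈M 0)) (coeff-≈ (*ₚ-cong {X} {[]} {f} X≈[] ≈ₚ-refl) 0)))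
    H-degree : ¬ (∃ λ s → HasDegree X s)
    H-degree (s , dX) = ℕ.<⇒≱ (ℕ.≤-trans 1≤n (ℕ.m≤n+m n s))
      (degree-≤ (X *ₚ f) (hasDegree-* X f s n dX f-degree)
        (degreeAtMost-≈ (≈ₚ-sym Hf≈M) λ { (suc i) _ → refl }))

  split : ∀ {x y} → ι f ≈ℚ x *ℚ y → x ℚ[x].∣ₚ constℚ 1ℚ ⊎ y ℚ[x].∣ₚ constℚ 1ℚ
  split {x} {y} f≈xy = ⊎.map (integralMultiple-unit Ix) (integralMultiple-unit Iy)
    (eisenstein-split-· q-prime E (M ℕ.* N) {{ℕ.m*n≢0 M N {{M≢0}} {{N≢0}}}} X Y XY≈MNf)
    where
    Ix = integralMultiple x
    Iy = integralMultiple y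
    open IntegralMultiple Ix
    open IntegralMultiple Iy renaming (M to N; M≢0 to N≢0; X to Y; M·x≈X to N·y≈Y)
    XY≈MNf : X *ₚ Y ≈ₚ + (M ℕ.* N) ·ₚ f
    XY≈MNf = ι-injective (begin
      ι (X *ₚ Y)                                       ≈⟨ ι-homo-* X Y ⟩
      ι X *ℚ ι Y                                       ≈⟨ ℚₚ.*ₚ-cong M·x≈X N·y≈Y ⟨
      (fromℤ (+ M) ·ℚ x) *ℚ (fromℤ (+ N) ·ℚ y)         ≈⟨ ·-*-interchange (fromℤ (+ M)) (fromℤ (+ N)) x y ⟩
      (fromℤ (+ M) ℚ.* fromℤ (+ N)) ·ℚ (x *ℚ y)        ≈⟨ ℚₚ.·ₚ-cong (trans (cong fromℤ (ℤ.pos-* M N)) (fromℤ-homo-* (+ M) (+ N))) f≈xy ⟨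
      fromℤ (+ (M ℕ.* N)) ·ℚ ι f                       ≈⟨ ι-homo-· (+ (M ℕ.* N)) f ⟨
      ι (+ (M ℕ.* N) ·ₚ f)                             ∎)
      where open ℚₚ.≈ₚ-Reasoning

-- Lucas polynomials as forms in d² and g

-- The absorption identity, free of division; Pascal's rule carries the induction.
[1+k]*[1+n]C[1+k]≡[1+n]*nCk : ∀ n k → suc k ℕ.* (suc n C suc k) ≡ suc n ℕ.* (n C k)
[1+k]*[1+n]C[1+k]≡[1+n]*nCk zero    zero    = refl
[1+k]*[1+n]C[1+k]≡[1+n]*nCk zero    (suc k) = trans
  (cong (suc (suc k) ℕ.*_) (k>n⇒nCk≡0 {1} {suc (suc k)} (s≤s (s≤s z≤n))))
  (trans (ℕ.*-zeroʳ (suc (suc k))) (sym (trans (ℕ.*-identityˡ _) (k>n⇒nCk≡0 {0} {suc k} (s≤s z≤n)))))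
[1+k]*[1+n]C[1+k]≡[1+n]*nCk (suc n) zero    =
  trans (ℕ.*-identityˡ _) (trans (nC1≡n (suc (suc n))) (sym (ℕ.*-identityʳ _)))
[1+k]*[1+n]C[1+k]≡[1+n]*nCk (suc n) (suc k) = begin
  suc (suc k) ℕ.* (suc (suc n) C suc (suc k))                    ≡⟨ cong (suc (suc k) ℕ.*_) (nCk+nC[k+1]≡[n+1]C[k+1] (suc n) (suc k)) ⟨
  suc (suc k) ℕ.* (x ℕ.+ y)                                      ≡⟨ expand k x y ⟩
  x ℕ.+ (suc k ℕ.* x ℕ.+ suc (suc k) ℕ.* y)                      ≡⟨ cong (x ℕ.+_) (cong₂ ℕ._+_ ([1+k]*[1+n]C[1+k]≡[1+n]*nCk n k) ([1+k]*[1+n]C[1+k]≡[1+n]*nCk n (suc k))) ⟩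
  x ℕ.+ (suc n ℕ.* (n C k) ℕ.+ suc n ℕ.* (n C suc k))            ≡⟨ cong (x ℕ.+_) (ℕ.*-distribˡ-+ (suc n) (n C k) (n C suc k)) ⟨
  x ℕ.+ suc n ℕ.* (n C k ℕ.+ n C suc k)                          ≡⟨ cong (λ z → x ℕ.+ suc n ℕ.* z) (nCk+nC[k+1]≡[n+1]C[k+1] n k) ⟩
  suc (suc n) ℕ.* x                                              ∎
  where
  open ≡-Reasoning
  x = suc n C suc k
  y = suc n C suc (suc k)
  expand : ∀ k x y → suc (suc k) ℕ.* (x ℕ.+ y) ≡ x ℕ.+ (suc k ℕ.* x ℕ.+ suc (suc k) ℕ.* y)
  expand = solve-∀

-- lucasCoeff j i is the coefficient of dʲ gⁱ in the Lucas polynomial of index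
-- j + 2i with initial values 2 and d.
lucasCoeff : ℕ → ℕ → ℕ
lucasCoeff zero    i       = 2
lucasCoeff (suc j) zero    = 1
lucasCoeff (suc j) (suc i) = lucasCoeff j (suc i) ℕ.+ lucasCoeff (suc j) i

-- Both binomial coefficients obey Pascal's rule, hence so does their sum, and at j = 0 each equals
-- 1. This is also the count of tilings of a cycle by j squares and i + 1 dominoes.
lucasCoeff-C : ∀ j i → lucasCoeff j (suc i) ≡ (suc (j ℕ.+ i) C suc i) ℕ.+ ((j ℕ.+ i) C i)
lucasCoeff-C zero    i       = sym (cong₂ ℕ._+_ (nCn≡1 (suc i)) (nCn≡1 i))
lucasCoeff-C (suc j) zero    = begin
  lucasCoeff j 1 ℕ.+ 1                                        ≡⟨ cong (ℕ._+ 1) (lucasCoeff-C j 0) ⟩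
  (suc (j ℕ.+ 0) C 1) ℕ.+ 1 ℕ.+ 1                              ≡⟨ cong (λ z → z ℕ.+ 1 ℕ.+ 1) (nC1≡n (suc (j ℕ.+ 0))) ⟩
  suc (j ℕ.+ 0) ℕ.+ 1 ℕ.+ 1                                    ≡⟨ cong (ℕ._+ 1) (trans (ℕ.+-comm (suc (j ℕ.+ 0)) 1) (sym (nC1≡n (suc (suc (j ℕ.+ 0)))))) ⟩
  (suc (suc j ℕ.+ 0) C 1) ℕ.+ ((suc j ℕ.+ 0) C 0)                ∎
  where open ≡-Reasoning
lucasCoeff-C (suc j) (suc i) = begin
  lucasCoeff j (suc (suc i)) ℕ.+ lucasCoeff (suc j) (suc i)
    ≡⟨ cong₂ ℕ._+_ (lucasCoeff-C j (suc i)) (lucasCoeff-C (suc j) i) ⟩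
  ((suc n C suc (suc i)) ℕ.+ (n C suc i)) ℕ.+ ((suc (suc (j ℕ.+ i)) C suc i) ℕ.+ (suc (j ℕ.+ i) C i))
    ≡⟨ cong (λ z → ((suc n C suc (suc i)) ℕ.+ (n C suc i)) ℕ.+ ((suc z C suc i) ℕ.+ (z C i))) (sym (ℕ.+-suc j i)) ⟩
  ((suc n C suc (suc i)) ℕ.+ (n C suc i)) ℕ.+ ((suc n C suc i) ℕ.+ (n C i))
    ≡⟨ rearrange (suc n C suc (suc i)) (n C suc i) (suc n C suc i) (n C i) ⟩
  ((suc n C suc i) ℕ.+ (suc n C suc (suc i))) ℕ.+ ((n C i) ℕ.+ (n C suc i))
    ≡⟨ cong₂ ℕ._+_ (nCk+nC[k+1]≡[n+1]C[k+1] (suc n) (suc i)) (nCk+nC[k+1]≡[n+1]C[k+1] n i) ⟩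
  (suc (suc n) C suc (suc i)) ℕ.+ (suc n C suc i)
    ∎
  where
  open ≡-Reasoning
  n = j ℕ.+ suc i
  rearrange : ∀ w x y z → (w ℕ.+ x) ℕ.+ (y ℕ.+ z) ≡ (y ℕ.+ w) ℕ.+ (z ℕ.+ x)
  rearrange = solve-∀

-- Absorption turns the second binomial coefficient of `lucasCoeff-C` into a multiple of the first.
-- The result is the classical N/(N-i) formula with the denominator cleared and i replaced by i + 1.
[j+i]*lucasCoeff : ∀ j i → suc (j ℕ.+ i) ℕ.* lucasCoeff j (suc i) ≡
                   (j ℕ.+ suc i ℕ.* 2) ℕ.* (suc (j ℕ.+ i) C suc i)
[j+i]*lucasCoeff j i = begin
  suc n ℕ.* lucasCoeff j (suc i)                              ≡⟨ cong (suc n ℕ.*_) (lucasCoeff-C j i) ⟩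
  suc n ℕ.* ((suc n C suc i) ℕ.+ (n C i))                     ≡⟨ ℕ.*-distribˡ-+ (suc n) (suc n C suc i) (n C i) ⟩
  suc n ℕ.* (suc n C suc i) ℕ.+ suc n ℕ.* (n C i)             ≡⟨ cong (suc n ℕ.* (suc n C suc i) ℕ.+_) ([1+k]*[1+n]C[1+k]≡[1+n]*nCk n i) ⟨
  suc n ℕ.* (suc n C suc i) ℕ.+ suc i ℕ.* (suc n C suc i)     ≡⟨ collect j i (suc n C suc i) ⟩
  (j ℕ.+ suc i ℕ.* 2) ℕ.* (suc n C suc i)                     ∎
  where
  open ≡-Reasoning
  n = j ℕ.+ i
  collect : ∀ j i x → suc (j ℕ.+ i) ℕ.* x ℕ.+ suc i ℕ.* x ≡ (j ℕ.+ suc i ℕ.* 2) ℕ.* x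
  collect = solve-∀

-- For 2i + 1 = q this is the coefficient of the pure power of g in L_q / p₁. It is q itself, whence
-- a single factor q in the constant term.
lucasCoeff-1 : ∀ i → lucasCoeff 1 i ≡ suc (i ℕ.* 2)
lucasCoeff-1 zero    = refl
lucasCoeff-1 (suc i) = cong (2 ℕ.+_) (lucasCoeff-1 i)

-- q divides (j + i + 1) times the coefficient, and q = (j + i + 1) + (i + 1) exceeds the first
-- factor.
prime∣lucasCoeff : ∀ {q} → Prime q → ∀ j i → j ℕ.+ suc i ℕ.* 2 ≡ q → q ℕ.∣ lucasCoeff j (suc i)
prime∣lucasCoeff {q} q-prime j i j+2i≡q
  with euclidsLemma (suc (j ℕ.+ i)) (lucasCoeff j (suc i)) q-prime
         (ℕ.divides (suc (j ℕ.+ i) C suc i)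
           (trans ([j+i]*lucasCoeff j i) (trans (cong (ℕ._* (suc (j ℕ.+ i) C suc i)) j+2i≡q) (ℕ.*-comm q (suc (j ℕ.+ i) C suc i)))))
... | inj₂ q∣c   = q∣c
... | inj₁ q∣j+i = contradiction (ℕ.∣⇒≤ q∣j+i)
  (ℕ.<⇒≱ (subst (suc (j ℕ.+ i) <_) (trans (expand j i) j+2i≡q) (s≤s (ℕ.m≤m+n (suc (j ℕ.+ i)) i))))
  where
  expand : ∀ j i → suc (suc (j ℕ.+ i) ℕ.+ i) ≡ j ℕ.+ suc i ℕ.* 2
  expand = solve-∀

-- The exponent of d is counted in powers of d²; for odd index one factor d has been split off.
evenCoeff oddCoeff : ℕ → ℕ → ℤ
evenCoeff j i = + lucasCoeff (j ℕ.* 2) i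
oddCoeff  j i = + lucasCoeff (suc (j ℕ.* 2)) i

module _ (S : LucasType) where
  open LucasType S

  -- Scaling by α normalises the initial values to 2 and d, so that the coefficients no longer
  -- depend on `p₀`. The division is exact in each of the four cases 1, -1, 2, -2.
  α*p₀≡2 : α ℤ.* p₀ ≡ + 2
  α*p₀≡2 = exact p₀ {{p₀-nonZero}} ∣p₀∣
    where
    exact : ∀ z .{{_ : ℤ.NonZero z}} → ℤ.∣ z ∣ ≡ 1 ⊎ ℤ.∣ z ∣ ≡ 2 → (+ 2 ℤ./ z) ℤ.* z ≡ + 2
    exact (+ 1)     (inj₁ refl) = refl
    exact -[1+ 0 ]  (inj₁ refl) = refl
    exact (+ 2)     (inj₂ refl) = refl
    exact -[1+ 1 ]  (inj₂ refl) = refl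

  evenForm oddForm : ℕ → Poly
  evenForm = form (d *ₚ d) g evenCoeff
  oddForm  = form (d *ₚ d) g oddCoeff

  evenForm-suc : ∀ m → (d *ₚ d) *ₚ oddForm m +ₚ g *ₚ evenForm m ≈ₚ evenForm (suc m)
  evenForm-suc m = begin
    (d *ₚ d) *ₚ oddForm m +ₚ g *ₚ evenForm m
      ≈⟨ +ₚ-cong (*ₚ-form-shiftˡ (d *ₚ d) g oddCoeff m) (*ₚ-form-shiftʳ (d *ₚ d) g evenCoeff m) ⟩
    form (d *ₚ d) g (shiftˡ oddCoeff) (suc m) +ₚ form (d *ₚ d) g (shiftʳ evenCoeff) (suc m)
      ≈⟨ form-+ (d *ₚ d) g (shiftˡ oddCoeff) (shiftʳ evenCoeff) (suc m) ⟩
    form (d *ₚ d) g (λ j i → shiftˡ oddCoeff j i ℤ.+ shiftʳ evenCoeff j i) (suc m)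
      ≈⟨ form-cong (d *ₚ d) g {c′ = evenCoeff} (suc m) coeffs ⟩
    evenForm (suc m) ∎
    where
    open ≈ₚ-Reasoning
    -- Off the excluded index (0, 0), where the left side is 0 and the right side 2, this is the
    -- recurrence of `lucasCoeff`.
    coeffs : ∀ j i → j ℕ.+ i ≡ suc m → shiftˡ oddCoeff j i ℤ.+ shiftʳ evenCoeff j i ≡ evenCoeff j i
    coeffs zero    (suc i) _ = refl
    coeffs (suc j) zero    _ = refl
    coeffs (suc j) (suc i) _ = refl

  oddForm-suc : ∀ m → evenForm (suc m) +ₚ g *ₚ oddForm m ≈ₚ oddForm (suc m)
  oddForm-suc m = begin
    evenForm (suc m) +ₚ g *ₚ oddForm m
      ≈⟨ +ₚ-cong (≈ₚ-refl {evenForm (suc m)}) (*ₚ-form-shiftʳ (d *ₚ d) g oddCoeff m) ⟩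
    evenForm (suc m) +ₚ form (d *ₚ d) g (shiftʳ oddCoeff) (suc m)
      ≈⟨ form-+ (d *ₚ d) g evenCoeff (shiftʳ oddCoeff) (suc m) ⟩
    form (d *ₚ d) g (λ j i → evenCoeff j i ℤ.+ shiftʳ oddCoeff j i) (suc m)
      ≈⟨ form-cong (d *ₚ d) g {c′ = oddCoeff} (suc m) coeffs ⟩
    oddForm (suc m) ∎
    where
    open ≈ₚ-Reasoning
    coeffs : ∀ j i → j ℕ.+ i ≡ suc m → evenCoeff j i ℤ.+ shiftʳ oddCoeff j i ≡ oddCoeff j i
    coeffs zero    (suc i) _ = refl
    coeffs (suc j) zero    _ = refl
    coeffs (suc j) (suc i) _ = refl

  -- Even terms keep the scalar α, odd ones the factor `p₁`. In each step of the recurrence d = α p₁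
  -- lets α pass between the factors, so that it is never divided out.
  α·L-even : ∀ m → α ·ₚ L (m ℕ.* 2) ≈ₚ evenForm m
  L-odd    : ∀ m → L (suc (m ℕ.* 2)) ≈ₚ oddForm m *ₚ p₁

  α·L-even zero    = ∷-cong α*p₀≡2 ≈ₚ-refl
  α·L-even (suc m) = begin
    α ·ₚ (d *ₚ L₁ +ₚ g *ₚ L₀)                          ≈⟨ ·ₚ-distribˡ α (d *ₚ L₁) (g *ₚ L₀) ⟩
    α ·ₚ (d *ₚ L₁) +ₚ α ·ₚ (g *ₚ L₀)                   ≈⟨ +ₚ-cong (≈ₚ-sym (*ₚ-·ₚ-comm α d L₁)) (≈ₚ-sym (*ₚ-·ₚ-comm α g L₀)) ⟩
    d *ₚ (α ·ₚ L₁) +ₚ g *ₚ (α ·ₚ L₀)                   ≈⟨ +ₚ-cong (*ₚ-congˡ d αL₁≈dF) (*ₚ-congˡ g (α·L-even m)) ⟩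
    d *ₚ (d *ₚ oddForm m) +ₚ g *ₚ evenForm m           ≈⟨ +ₚ-cong (*ₚ-assoc d d (oddForm m)) ≈ₚ-refl ⟨
    (d *ₚ d) *ₚ oddForm m +ₚ g *ₚ evenForm m           ≈⟨ evenForm-suc m ⟩
    evenForm (suc m)                                   ∎
    where
    open ≈ₚ-Reasoning
    L₀ = L (m ℕ.* 2)
    L₁ = L (suc (m ℕ.* 2))
    αL₁≈dF : α ·ₚ L₁ ≈ₚ d *ₚ oddForm m
    αL₁≈dF = begin
      α ·ₚ L₁                  ≈⟨ ·ₚ-congˡ α (L-odd m) ⟩
      α ·ₚ (oddForm m *ₚ p₁)   ≈⟨ *ₚ-·ₚ-comm α (oddForm m) p₁ ⟨
      oddForm m *ₚ d           ≈⟨ *ₚ-comm (oddForm m) d ⟩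
      d *ₚ oddForm m           ∎

  L-odd zero    = ≈ₚ-sym (*ₚ-identityˡ p₁)
  L-odd (suc m) = begin
    d *ₚ L₂ +ₚ g *ₚ L₁                                 ≈⟨ +ₚ-cong (dL₂≈Ep₁ (α·L-even (suc m))) (*ₚ-congˡ g (L-odd m)) ⟩
    evenForm (suc m) *ₚ p₁ +ₚ g *ₚ (oddForm m *ₚ p₁)   ≈⟨ +ₚ-cong (≈ₚ-refl {evenForm (suc m) *ₚ p₁}) (*ₚ-assoc g (oddForm m) p₁) ⟨
    evenForm (suc m) *ₚ p₁ +ₚ (g *ₚ oddForm m) *ₚ p₁   ≈⟨ *ₚ-distribʳ p₁ (evenForm (suc m)) (g *ₚ oddForm m) ⟨
    (evenForm (suc m) +ₚ g *ₚ oddForm m) *ₚ p₁         ≈⟨ *ₚ-cong (oddForm-suc m) ≈ₚ-refl ⟩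
    oddForm (suc m) *ₚ p₁                              ∎
    where
    open ≈ₚ-Reasoning
    L₁ = L (suc (m ℕ.* 2))
    L₂ = L (suc m ℕ.* 2)
    dL₂≈Ep₁ : α ·ₚ L₂ ≈ₚ evenForm (suc m) → d *ₚ L₂ ≈ₚ evenForm (suc m) *ₚ p₁
    dL₂≈Ep₁ αL₂≈E = begin
      (α ·ₚ p₁) *ₚ L₂           ≈⟨ ·ₚ-*ₚ-assoc α p₁ L₂ ⟩
      α ·ₚ (p₁ *ₚ L₂)           ≈⟨ *ₚ-·ₚ-comm α p₁ L₂ ⟨
      p₁ *ₚ (α ·ₚ L₂)           ≈⟨ *ₚ-comm p₁ (α ·ₚ L₂) ⟩
      (α ·ₚ L₂) *ₚ p₁           ≈⟨ *ₚ-cong αL₂≈E ≈ₚ-refl ⟩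
      evenForm (suc m) *ₚ p₁    ∎

-- Degree and order of a form

degreeAtMost-^ : ∀ p {K} → DegreeAtMost p K → ∀ n → DegreeAtMost (p ^ₚ n) (n ℕ.* K)
degreeAtMost-^ p     p≤K zero    (suc i) _ = refl
degreeAtMost-^ p {K} p≤K (suc n) = degreeAtMost-* p (p ^ₚ n) K (n ℕ.* K) p≤K (degreeAtMost-^ p p≤K n)

degreeAtMost-form : ∀ u v c {K} → DegreeAtMost u K → DegreeAtMost v K →
                    ∀ n → DegreeAtMost (form u v c n) (n ℕ.* K)
degreeAtMost-form u v c     u≤K v≤K zero    (suc i) _ = refl
degreeAtMost-form u v c {K} u≤K v≤K (suc n) = degreeAtMost-+ (u *ₚ form u v _ n) _
  (degreeAtMost-* u (form u v _ n) K (n ℕ.* K) u≤K (degreeAtMost-form u v _ u≤K v≤K n))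
  (degreeAtMost-· (c 0 (suc n)) (v ^ₚ suc n) (degreeAtMost-^ v v≤K (suc n)))

module _ {q : ℕ} (q-prime : Prime q) where

  ∤1 : ¬ (+ q ∣ₛ 1ℤ)
  ∤1 q∣1 = contradiction (subst Prime (ℕ.∣1⇒≡1 (∣⇒∣ᵤ q∣1)) q-prime) ¬prime[1]

  hasOrder-^ : ∀ p {K} → HasOrder q-prime p K → ∀ n → HasOrder q-prime (p ^ₚ n) (n ℕ.* K)
  hasOrder-^ p ord zero    = (λ _ ()) , ∤1
  hasOrder-^ p ord (suc n) = hasOrder-* q-prime p (p ^ₚ n) ord (hasOrder-^ p ord n)

  -- Modulo q every term with a positive power of v drops out, which leaves c(n,0) uⁿ.
  hasOrder-form : ∀ u v c {K} n → HasOrder q-prime u K → ¬ (+ q ∣ₛ c n 0) →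
                  (∀ j i → j ℕ.+ suc i ≡ n → + q ∣ₛ c j (suc i)) →
                  HasOrder q-prime (form u v c n) (n ℕ.* K)
  hasOrder-form u v c zero    ord q∤c q∣c = (λ _ ()) , q∤c
  hasOrder-form u v c (suc n) ord q∤c q∣c = hasOrder-+ q-prime (u *ₚ form u v _ n) _
    (hasOrder-* q-prime u (form u v _ n) ord
      (hasOrder-form u v _ n ord q∤c λ j i j+i≡n → q∣c (suc j) i (cong suc j+i≡n)))
    (λ i → subst (+ q ∣ₛ_) (sym (coeff-·ₚ (c 0 (suc n)) (v ^ₚ suc n) i)) (∣m⇒∣m*n _ (q∣c 0 n refl)))

  -- `suc m` in place of `m` records that q is at least 3, so that the form of degree (q-1)/2 is not
  -- constant.
  odd-prime : 2 < q → ∃ λ m → q ≡ suc (suc m ℕ.* 2)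
  odd-prime 2<q with q ℕ.% 2 | ℕ.m%n<n q 2 | q ℕ./ 2 | ℕ.m≡m%n+[m/n]*n q 2
  ... | 0 | _ | m     | q≡2m   = contradiction
    ([ (λ ()) , (λ 2≡q → ℕ.<⇒≢ 2<q 2≡q) ]′ (prime⇒irreducible q-prime (ℕ.divides m q≡2m)))
    λ ()
  ... | 1 | _ | zero  | q≡1    = contradiction (subst (2 <_) q≡1 2<q) λ { (s≤s ()) }
  ... | 1 | _ | suc m | q≡2m+3 = m , q≡2m+3
  ... | suc (suc _) | s≤s (s≤s ()) | _ | _

coeff-applyUpTo-< : ∀ (a : ℕ → ℤ) {n i} → i < n → coeff (applyUpTo a n) i ≡ a i
coeff-applyUpTo-< a {suc n} {zero}  _         = refl
coeff-applyUpTo-< a {suc n} {suc i} (s≤s i<n) = coeff-applyUpTo-< (λ j → a (suc j)) i<n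

coeff-applyUpTo-≥ : ∀ (a : ℕ → ℤ) {n i} → n ≤ i → coeff (applyUpTo a n) i ≡ 0ℤ
coeff-applyUpTo-≥ a {zero}          _         = refl
coeff-applyUpTo-≥ a {suc n} {suc i} (s≤s n≤i) = coeff-applyUpTo-≥ (λ j → a (suc j)) n≤i

eval-0 : ∀ p → eval p 0ℤ ≡ coeff p 0
eval-0 []      = refl
eval-0 (a ∷ p) = ℤ.+-identityʳ a

-- The hypotheses of Eisenstein's criterion for L_q / p₁

module _ (S : LucasType) (A : StandingAssumptions S) {q : ℕ} (q-prime : Prime q)
         (k : ℕ) (a : ℕ → ℤ) (d≈a : LucasType.d S ≈ₚ applyUpTo a (suc k))
         (q∤aₖ : ¬ (+ q ∣ₛ a k)) (q∣a : ∀ i → i < k → + q ∣ₛ a i)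
         (q∤g₀ : ¬ (+ q ∣ₛ coeff (LucasType.g S) 0)) where
  open LucasType S
  open StandingAssumptions A

  d-order : HasOrder q-prime d k
  d-order =
    (λ i i<k → subst (+ q ∣ₛ_) (sym (dᵢ≡aᵢ (ℕ.m<n⇒m<1+n i<k))) (q∣a i i<k)) ,
    λ q∣dₖ → q∤aₖ (subst (+ q ∣ₛ_) (dᵢ≡aᵢ (ℕ.n<1+n k)) q∣dₖ)
    where
    dᵢ≡aᵢ : ∀ {i} → i < suc k → coeff d i ≡ a i
    dᵢ≡aᵢ {i} i≤k = trans (coeff-≈ d≈a i) (coeff-applyUpTo-< a i≤k)

  d≤k : DegreeAtMost d k
  d≤k i k<i = trans (coeff-≈ d≈a i) (coeff-applyUpTo-≥ a k<i)

  -- `d` is the multiple of the non-constant `p₁` by α, which is non-zero because α p₀ = 2, and k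
  -- bounds the degree of `d`.
  1≤k : 1 ≤ k
  1≤k with deg-p₁≥1
  ... | n , p₁-degree , 1≤n = ℕ.≤-trans 1≤n (degree-≤ d (hasDegree-· α {{α≢0}} p₁ ≈ₚ-refl p₁-degree) d≤k)
    where
    α≢0 : ℤ.NonZero α
    α≢0 = ℤ.≢-nonZero λ α≡0 → contradiction (trans (sym (α*p₀≡2 S)) (cong (ℤ._* p₀) {x = α} α≡0)) λ ()

  g≤2k : DegreeAtMost g (k ℕ.+ k)
  g≤2k with deg-g<d
  ... | m , n , (_ , g≤m) , d-degree , m<n = degreeAtMost-mono {g}
    (ℕ.≤-trans (ℕ.<⇒≤ m<n) (ℕ.≤-trans (degree-≤ d d-degree d≤k) (ℕ.m≤m+n k k))) g≤m

  oddForm-eisenstein : ∀ m → q ≡ suc (suc m ℕ.* 2) →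
                       Eisenstein q-prime (oddForm S (suc m)) (suc m ℕ.* (k ℕ.+ k))
  oddForm-eisenstein m q≡2m+3 = record
    { 1≤n      = ℕ.≤-trans 1≤k (ℕ.≤-trans (ℕ.m≤m+n k k) (ℕ.m≤m+n (k ℕ.+ k) (m ℕ.* (k ℕ.+ k))))
    ; order    = hasOrder-form q-prime d² g oddCoeff (suc m) (hasOrder-* q-prime d d d-order d-order) (∤1 q-prime)
                   λ j i j+i≡m → ∣ᵤ⇒∣ (prime∣lucasCoeff q-prime (suc (j ℕ.* 2)) i (index j i j+i≡m))
    ; degree≤n = degreeAtMost-form d² g oddCoeff (degreeAtMost-* d d k k d≤k d≤k) g≤2k (suc m)
    -- g has order 0, hence so have its powers; the order of the power appears as `suc m * 0`.
    ; q²∤f₀    = λ q²∣f₀ → proj₂ (hasOrder-^ q-prime g ((λ _ ()) , q∤g₀) (suc m))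
                   (subst (λ n → + q ∣ₛ coeff (g ^ₚ suc m) n) (sym (ℕ.*-zeroʳ (suc m))) (q∣gᵐ q²∣f₀))
    }
    where
    d² = d *ₚ d
    F  = form d² g (λ j → oddCoeff (suc j)) m

    index : ∀ j i → j ℕ.+ suc i ≡ suc m → suc (j ℕ.* 2) ℕ.+ suc i ℕ.* 2 ≡ q
    index j i j+i≡m = trans (cong suc (trans (sym (ℕ.*-distribʳ-+ 2 j (suc i))) (cong (ℕ._* 2) j+i≡m))) (sym q≡2m+3)

    -- The last clause of `form` already isolates the pure power of g, whose coefficient is q by
    -- `lucasCoeff-1`.
    f₀ : coeff (oddForm S (suc m)) 0 ≡
         coeff d 0 ℤ.* coeff d 0 ℤ.* coeff F 0 ℤ.+ + q ℤ.* coeff (g ^ₚ suc m) 0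
    f₀ = trans (coeff-+ₚ (d² *ₚ F) _ 0) (cong₂ ℤ._+_
      (trans (coeff-*ₚ-zero d² F) (cong (ℤ._* coeff F 0) (coeff-*ₚ-zero d d)))
      (trans (coeff-·ₚ (oddCoeff 0 (suc m)) (g ^ₚ suc m) 0)
        (cong (λ n → + n ℤ.* coeff (g ^ₚ suc m) 0) (trans (lucasCoeff-1 (suc m)) (sym q≡2m+3)))))

    q²∣d₀² : + q ℤ.* + q ∣ₛ coeff d 0 ℤ.* coeff d 0
    q²∣d₀² = ∣-trans (*-monoʳ-∣ (+ q) q∣d₀) (*-monoˡ-∣ (coeff d 0) q∣d₀)
      where
      q∣d₀ : + q ∣ₛ coeff d 0
      q∣d₀ = proj₁ d-order 0 1≤k

    -- As k ≥ 1, q divides d(0) and q² the part with d². What remains is q² ∣ q g(0)^(m+1), from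
    -- which one q cancels.
    q∣gᵐ : + q ℤ.* + q ∣ₛ coeff (oddForm S (suc m)) 0 → + q ∣ₛ coeff (g ^ₚ suc m) 0
    q∣gᵐ q²∣f₀ = *-cancelˡ-∣ (+ q) {{prime⇒nonZero q-prime}}
      (∣m+n∣m⇒∣n (subst (+ q ℤ.* + q ∣ₛ_) f₀ q²∣f₀) (∣m⇒∣m*n _ q²∣d₀²))

open LucasType using (p₁; g; d; L)

proposition4p6 : (S : LucasType) → StandingAssumptions S →
    (q : ℕ) → Prime q → 2 < q →
    (k : ℕ) (a : ℕ → ℤ) → d S ≈ₚ applyUpTo a (suc k) →
    ¬ ((+ q) ∣ a k) → (∀ i → i < k → (+ q) ∣ a i) →
    ¬ ((+ q) ∣ eval (g S) (+ 0)) →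
    ∃ λ f → f *ₚ p₁ S ≈ₚ L S q × IrreducibleOverℚ f
proposition4p6 S A q q-prime 2<q k a d≈a q∤aₖ q∣a q∤g₀ with odd-prime q-prime 2<q
... | m , refl = oddForm S (suc m) , ≈ₚ-sym (L-odd S (suc m)) ,
  eisenstein-criterion q-prime (oddForm-eisenstein S A q-prime k a d≈a
    (λ q∣aₖ → q∤aₖ (∣⇒∣ᵤ q∣aₖ)) (λ i i<k → ∣ᵤ⇒∣ (q∣a i i<k))
    (λ q∣g₀ → q∤g₀ (∣⇒∣ᵤ (subst (+ q ∣ₛ_) (sym (eval-0 (g S))) q∣g₀)))
    m refl)
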